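{- Let $G=\mathbb Q^{(\omega)}=\bigoplus_{i\in\mathbb N}G_i$, where each $G_i$ is an isomorphic copy of $\mathbb Q$, and let $\mathcal P$ be the collection of all finite (possibly empty) subsets of $\mathbb N$. For $I\in\mathcal P$ let $H_I$ be the subgroup of $G$ consisting of the elements which are $0$ in every coordinate outside $I$. Then the structure $\mathcal G=(G,+,(H_I)_{I\in\mathcal P})$ is $\omega$-stable of Morley rank $\omega$ and does not have finite dp-rank.
   Context: The language of $\mathcal G$ is the language of abelian groups together with a unary predicate for each subgroup $H_I$. An inp-pattern of depth $\kappa$ for a partial type $\pi(x)$ is a sequence of formulas $(\varphi^\alpha(x,y^\alpha))_{\alpha<\kappa}$ together with natural numbers $(k^\alpha)_{\alpha<\kappa}$ such that there is an array of tuples $(b_i^\alpha)_{\alpha<\kappa,i<\omega}$ in a sufficiently saturated model for which each row $\{\varphi^\alpha(x,b_i^\alpha)\}_{i<\omega}$ is $k^\alpha$-inconsistent, while for every $\eta:\kappa\to\omega$ the path $\pi(x)\cup\{\varphi^\alpha(x,b^\alpha_{\eta(\alpha)})\}_{\alpha<\kappa}$ is consistent. In a stable theory the dp-rank of $\pi$ is the supremum of the cardinals $\kappa$ for which there is an inp-pattern of depth $\kappa$ for $\pi$. The dp-rank of a stable structure is the dp-rank of $\{x=x\}$ ($x$ a single variable). -}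

module Defs where

open import Level using (Lift; 0ℓ) renaming (suc to lsuc; _⊔_ to _⊔ℓ_)
open import Data.Fin.Base using (Fin)
open import Data.List.Base using (List)
import Data.List.Membership.Propositional as List
open import Data.List.Relation.Unary.Linked using (Linked)
open import Data.Nat.Base as ℕ using (ℕ; zero; suc; _⊔_; _≤_; _<_)
import Data.Nat.Properties as ℕ
open import Data.Product.Base using (Σ-syntax; ∃; ∃-syntax; _×_; _,_; proj₁)
open import Data.Rational.Base as ℚ using (ℚ; 0ℚ)
open import Data.Sum.Base using (_⊎_)
open import Data.Vec.Base using (Vec; []; _∷_; _++_; lookup; map)
open import Data.Vec.Relation.Binary.Pointwise.Inductive using (Pointwise; []; _∷_)
open import Function.Base using (id; _∘_)
open import Function.Bundles using (Injection; _↣_; _⇔_; mk⇔; module Equivalence)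
open import Function.Definitions using (Injective)
open import Relation.Binary.Bundles using (Setoid)
open import Relation.Binary.PropositionalEquality as ≡ using (_≡_; _≢_; refl)
open import Relation.Nullary.Negation.Core using (¬_)
open import Relation.Unary using (Pred)

----------------------------------------------------------------------
-- First-order logic

record Signature : Set₁ where
  field
    Fun : ℕ → Set
    Rel : ℕ → Set

module _ (L : Signature) where
  open Signature L

  data Term (n : ℕ) : Set where
    var : Fin n → Term n
    fun : ∀ {k} → Fun k → Vec (Term n) k → Term n

  -- Formula n: free variables among n many.  In `ex' φ` the bound variable
  -- is variable 0 of φ.
  infix  8 _≐_
  infixr 6 _∧'_

  data Formula (n : ℕ) : Set where
    _≐_  : Term n → Term n → Formula n
    rel  : ∀ {k} → Rel k → Vec (Term n) k → Formula n
    ¬'_  : Formula n → Formula n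
    _∧'_ : Formula n → Formula n → Formula n
    ex'  : Formula (suc n) → Formula n

  -- Equality of the structure is the equality of a setoid (needed because
  -- there are no quotient types); every symbol must respect it.
  record Structure : Set₁ where
    field
      domain : Setoid 0ℓ 0ℓ
    open Setoid domain public using (Carrier; _≈_)
    field
      ⟦fun⟧    : ∀ {k} → Fun k → Vec Carrier k → Carrier
      fun-cong : ∀ {k} (f : Fun k) {u v} → Pointwise _≈_ u v → ⟦fun⟧ f u ≈ ⟦fun⟧ f v
      ⟦rel⟧    : ∀ {k} → Rel k → Vec Carrier k → Set
      rel-resp : ∀ {k} (r : Rel k) {u v} → Pointwise _≈_ u v → ⟦rel⟧ r u → ⟦rel⟧ r v

module _ {L : Signature} where

  ∣_∣ : Structure L → Set
  ∣ M ∣ = Structure.Carrier M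

  module _ (M : Structure L) where
    open Structure M

    eval  : ∀ {n} → Vec ∣ M ∣ n → Term L n → ∣ M ∣
    evals : ∀ {n k} → Vec ∣ M ∣ n → Vec (Term L n) k → Vec ∣ M ∣ k
    eval v (var i)    = lookup v i
    eval v (fun f ts) = ⟦fun⟧ f (evals v ts)
    evals v []       = []
    evals v (t ∷ ts) = eval v t ∷ evals v ts

  infix 4 _⊨_[_]

  _⊨_[_] : ∀ {n} (M : Structure L) → Formula L n → Vec ∣ M ∣ n → Set
  M ⊨ s ≐ t    [ v ] = Structure._≈_ M (eval M v s) (eval M v t)
  M ⊨ rel r ts [ v ] = Structure.⟦rel⟧ M r (evals M v ts)
  M ⊨ ¬' φ     [ v ] = ¬ (M ⊨ φ [ v ])
  M ⊨ φ ∧' ψ   [ v ] = (M ⊨ φ [ v ]) × (M ⊨ ψ [ v ])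
  M ⊨ ex' φ    [ v ] = Σ[ x ∈ ∣ M ∣ ] (M ⊨ φ [ x ∷ v ])

  infix 4 _≡ₑ_

  _≡ₑ_ : Structure L → Structure L → Set
  M ≡ₑ N = ∀ (φ : Formula L 0) → (M ⊨ φ [ [] ]) ⇔ (N ⊨ φ [ [] ])

  -- (M , a) and (N , c) satisfy the same sentences after adding a constant
  -- for each element of A; that is, N with c is a model of Th_A(M).
  SameTheory : {A : Set} (M : Structure L) (a : A → ∣ M ∣)
               (N : Structure L) (c : A → ∣ N ∣) → Set
  SameTheory {A} M a N c =
    ∀ {m} (φ : Formula L m) (w : Vec A m) →
    (M ⊨ φ [ map a w ]) ⇔ (N ⊨ φ [ map c w ])

  infix 4 _≼_

  _≼_ : Structure L → Structure L → Set
  M ≼ N = Σ[ f ∈ (∣ M ∣ → ∣ N ∣) ] SameTheory M id N f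

----------------------------------------------------------------------
-- Formulas with parameters, partial and complete types

-- An L(A)-formula φ(x,b) in n variables x: an L-formula φ(x,y) with a
-- tuple b of names from A for y.
PFormula : (L : Signature) → Set → ℕ → Set
PFormula L A n = Σ[ m ∈ ℕ ] Formula L (n ℕ.+ m) × Vec A m

module _ {L : Signature} where

  mapParam : ∀ {A B : Set} {n} → (A → B) → PFormula L A n → PFormula L B n
  mapParam f (m , φ , b) = m , φ , map f b

  ¬ₚ_ : ∀ {A n} → PFormula L A n → PFormula L A n
  ¬ₚ (m , φ , b) = m , ¬' φ , b

  Holds : ∀ {A : Set} {n} (M : Structure L) (a : A → ∣ M ∣) →
          PFormula L A n → Vec ∣ M ∣ n → Set
  Holds M a (m , φ , b) x = M ⊨ φ [ x ++ map a b ]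

  -- Φ ∪ Th_A(M) has a model, where a : A → M interprets the parameters.
  Consistent : ∀ {A : Set} {n ℓ} (M : Structure L) (a : A → ∣ M ∣) →
               Pred (PFormula L A n) ℓ → Set (lsuc 0ℓ ⊔ℓ ℓ)
  Consistent {A} {n} M a Φ =
    Σ[ N ∈ Structure L ] Σ[ c ∈ (A → ∣ N ∣) ] SameTheory M a N c ×
    (Σ[ x ∈ Vec ∣ N ∣ n ] (∀ φ → Φ φ → Holds N c φ x))

  record CompleteType (M : Structure L) (A : Pred ∣ M ∣ 0ℓ) (n : ℕ) : Set₁ where
    field
      mem        : Pred (PFormula L (∃ A) n) 0ℓ
      consistent : Consistent M proj₁ mem
      complete   : ∀ φ → mem φ ⊎ mem (¬ₚ φ)

  -- Sₙ(A), types being equal when they contain the same formulas.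
  TypeSpace : (M : Structure L) (A : Pred ∣ M ∣ 0ℓ) (n : ℕ) → Setoid (lsuc 0ℓ) 0ℓ
  TypeSpace M A n = record
    { Carrier       = CompleteType M A n
    ; _≈_           = λ p q → ∀ φ → mem p φ ⇔ mem q φ
    ; isEquivalence = record
      { refl  = λ φ → mk⇔ id id
      ; sym   = λ e φ → mk⇔ (from (e φ)) (to (e φ))
      ; trans = λ e e′ φ → mk⇔ (to (e′ φ) ∘ to (e φ)) (from (e φ) ∘ from (e′ φ))
      }
    }
    where
    open CompleteType
    open Equivalence using (to; from)

----------------------------------------------------------------------
-- ω-stability

Countable : ∀ {c ℓ} → Setoid c ℓ → Set (c ⊔ℓ ℓ)
Countable S = Injection S (≡.setoid ℕ)

module _ {L : Signature} where

  SubsetSetoid : (M : Structure L) → Pred ∣ M ∣ 0ℓ → Setoid 0ℓ 0ℓ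
  SubsetSetoid M A = record
    { Carrier       = ∃ A
    ; _≈_           = λ x y → proj₁ x ≈ proj₁ y
    ; isEquivalence = record { refl = D.refl ; sym = D.sym ; trans = D.trans }
    }
    where
    open Structure M
    module D = Setoid domain

  ωStable : Structure L → Set₁
  ωStable G =
    ∀ (M : Structure L) → G ≡ₑ M →
    ∀ (A : Pred ∣ M ∣ 0ℓ) → Countable (SubsetSetoid M A) →
    ∀ n → Countable (TypeSpace M A n)

----------------------------------------------------------------------
-- Morley rank

-- Countable ordinals as trees; lim f denotes the supremum of the f i.
data Ord : Set where
  zero : Ord
  suc  : Ord → Ord
  lim  : (ℕ → Ord) → Ord

fin : ℕ → Ord
fin zero    = zero
fin (suc n) = suc (fin n)

ω : Ord
ω = lim fin

module _ {L : Signature} where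

  -- MR φ ≥ α, for a formula φ in one variable with parameters in M.  The
  -- parameters of the ψ i range over all elementary extensions of M, which
  -- plays the role of working inside a monster model.
  MR≥ : Ord → (M : Structure L) → PFormula L ∣ M ∣ 1 → Set₁
  MR≥ zero    M φ = Lift (lsuc 0ℓ) (Σ[ x ∈ Vec ∣ M ∣ 1 ] Holds M id φ x)
  MR≥ (suc α) M φ =
    Σ[ N ∈ Structure L ] Σ[ (f , _) ∈ M ≼ N ] Σ[ ψ ∈ (ℕ → PFormula L ∣ N ∣ 1) ]
      (∀ i x → Holds N id (ψ i) x → Holds N f φ x) ×
      (∀ i j → i ≢ j → ∀ x → ¬ (Holds N id (ψ i) x × Holds N id (ψ j) x)) ×
      (∀ i → MR≥ α N (ψ i))
  MR≥ (lim α) M φ = ∀ i → MR≥ (α i) M φ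

  x≐x : ∀ {A} → PFormula L A 1
  x≐x = 0 , var Fin.zero ≐ var Fin.zero , []

  HasMorleyRank : Structure L → Ord → Set₁
  HasMorleyRank M α = MR≥ α M x≐x × ¬ MR≥ (suc α) M x≐x

----------------------------------------------------------------------
-- inp-patterns and dp-rank

  -- An inp-pattern of depth K (a set, standing for its cardinality) for the
  -- partial type π with parameters in M.  An array exists in a sufficiently
  -- saturated extension of M iff one exists in some elementary extension N.
  record InpPattern (M : Structure L) {n : ℕ} (π : Pred (PFormula L ∣ M ∣ n) 0ℓ)
                    (K : Set) : Set₁ where
    field
      arity : K → ℕ
      φ     : ∀ α → Formula L (n ℕ.+ arity α)
      k     : K → ℕ
      N     : Structure L
      M≼N   : M ≼ N
      b     : ∀ α → ℕ → Vec ∣ N ∣ (arity α)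

    entry : K → ℕ → PFormula L ∣ N ∣ n
    entry α i = arity α , φ α , b α i

    Path : (K → ℕ) → Pred (PFormula L ∣ N ∣ n) 0ℓ
    Path η ψ = (∃[ χ ] (π χ × ψ ≡ mapParam (proj₁ M≼N) χ)) ⊎ (∃[ α ] ψ ≡ entry α (η α))

    field
      row-inconsistent : ∀ α (i : Fin (k α) → ℕ) → Injective _≡_ _≡_ i →
                         ¬ Consistent N id (λ ψ → ∃[ j ] ψ ≡ entry α (i j))
      path-consistent  : ∀ η → Consistent N id (Path η)

  -- The supremum of the depths of inp-patterns for {x = x} is at most d.
  dpRank≤ : Structure L → ℕ → Set₁
  dpRank≤ M d = ∀ (K : Set) → InpPattern M (_≡ x≐x) K → K ↣ Fin d

  FiniteDpRank : Structure L → Set₁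
  FiniteDpRank M = ∃[ d ] dpRank≤ M d

----------------------------------------------------------------------
-- The group ℚ^(ω) with the subgroups H_I

-- Finite subsets of ℕ as strictly increasing lists: each has exactly one
-- representation.
FinSubset : Set
FinSubset = Σ[ xs ∈ List ℕ ] Linked _<_ xs

infix 4 _∈_

_∈_ : ℕ → FinSubset → Set
i ∈ (xs , _) = i List.∈ xs

record ℚ^⟨ω⟩ : Set where
  field
    coord   : ℕ → ℚ
    bound   : ℕ
    support : ∀ i → bound ≤ i → coord i ≡ 0ℚ

open ℚ^⟨ω⟩ public

infix 4 _≈ᴳ_

_≈ᴳ_ : ℚ^⟨ω⟩ → ℚ^⟨ω⟩ → Set
g ≈ᴳ h = ∀ i → coord g i ≡ coord h i

0ᴳ : ℚ^⟨ω⟩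
0ᴳ = record { coord = λ _ → 0ℚ ; bound = 0 ; support = λ _ _ → refl }

_+ᴳ_ : ℚ^⟨ω⟩ → ℚ^⟨ω⟩ → ℚ^⟨ω⟩
g +ᴳ h = record
  { coord   = λ i → coord g i ℚ.+ coord h i
  ; bound   = bound g ⊔ bound h
  ; support = λ i le → ≡.cong₂ ℚ._+_
      (support g i (ℕ.≤-trans (ℕ.m≤m⊔n (bound g) (bound h)) le))
      (support h i (ℕ.≤-trans (ℕ.m≤n⊔m (bound g) (bound h)) le))
  }

-ᴳ_ : ℚ^⟨ω⟩ → ℚ^⟨ω⟩
-ᴳ g = record
  { coord   = λ i → ℚ.- coord g i
  ; bound   = bound g
  ; support = λ i le → ≡.cong ℚ.-_ (support g i le)
  }

H : FinSubset → Pred ℚ^⟨ω⟩ 0ℓ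
H I g = ∀ i → ¬ (i ∈ I) → coord g i ≡ 0ℚ

data GroupFun : ℕ → Set where
  0# : GroupFun 0
  +# : GroupFun 2
  -# : GroupFun 1

data SubgroupRel : ℕ → Set where
  H# : FinSubset → SubgroupRel 1

𝓛 : Signature
𝓛 = record { Fun = GroupFun ; Rel = SubgroupRel }

𝓖 : Structure 𝓛
𝓖 = record
  { domain   = record
    { Carrier       = ℚ^⟨ω⟩
    ; _≈_           = _≈ᴳ_
    ; isEquivalence = record
      { refl  = λ i → refl
      ; sym   = λ p i → ≡.sym (p i)
      ; trans = λ p q i → ≡.trans (p i) (q i)
      }
    }
  ; ⟦fun⟧    = ⟦fun⟧
  ; fun-cong = fun-cong
  ; ⟦rel⟧    = ⟦rel⟧
  ; rel-resp = rel-resp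
  }
  where
  ⟦fun⟧ : ∀ {k} → GroupFun k → Vec ℚ^⟨ω⟩ k → ℚ^⟨ω⟩
  ⟦fun⟧ 0# []           = 0ᴳ
  ⟦fun⟧ +# (g ∷ h ∷ []) = g +ᴳ h
  ⟦fun⟧ -# (g ∷ [])     = -ᴳ g

  fun-cong : ∀ {k} (f : GroupFun k) {u v} → Pointwise _≈ᴳ_ u v → ⟦fun⟧ f u ≈ᴳ ⟦fun⟧ f v
  fun-cong 0# []           i = refl
  fun-cong +# (p ∷ q ∷ []) i = ≡.cong₂ ℚ._+_ (p i) (q i)
  fun-cong -# (p ∷ [])     i = ≡.cong ℚ.-_ (p i)

  ⟦rel⟧ : ∀ {k} → SubgroupRel k → Vec ℚ^⟨ω⟩ k → Set
  ⟦rel⟧ (H# I) (g ∷ []) = H I g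

  rel-resp : ∀ {k} (r : SubgroupRel k) {u v} → Pointwise _≈ᴳ_ u v → ⟦rel⟧ r u → ⟦rel⟧ r v
  rel-resp (H# I) (p ∷ []) g∈H i i∉I = ≡.trans (≡.sym (p i)) (g∈H i i∉I)

{-# OPTIONS --safe #-}

-- In a model of the theory of 𝓖 the H_I form a distributive lattice of ℚ-subspaces
-- with H_I ∩ H_J = H_(I ∩ J) and H_I + H_J = H_(I ∪ J).  Hence finitely many cosets of
-- them intersect as soon as they do so pairwise modulo the H_(I ∪ J), and a coset is
-- covered by finitely many others only if one of them contains it.  This yields quantifier
-- elimination down to conditions q₁x₁ + … + qₙxₙ ∈ H_I.
--
-- ω-stability: over a tuple, a further element is determined by finitely many such
-- conditions, so types over a countable set have codes in ℕ.  Morley rank: inside a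
-- coset of H_I, and in the whole model, a definable set or its complement is covered by
-- finitely many strictly smaller cosets, so a coset of H_I has rank ∣I∣ and the model
-- has rank ω.  dp-rank: for ∣I∣ = n the cosets of the H_(I ∖ {α}) in H_I, α ∈ I, form an
-- inp-pattern of depth n.
module Submission where

open import Defs
open import Axiom.ExcludedMiddle using (ExcludedMiddle)
open import Data.Product.Base using (_×_)
open import Relation.Nullary.Negation.Core using (¬_)

open import Level using (0ℓ; lift)
open import Algebra.Bundles using (AbelianGroup; Ring)
import Algebra.Properties.AbelianGroup
import Algebra.Properties.Monoid.Mult
import Algebra.Properties.CommutativeMonoid.Mult
import Algebra.Properties.CommutativeSemigroup
import Algebra.Properties.Semiring.Mult
open import Data.Empty using (⊥; ⊥-elim)
open import Data.Fin.Base as Fin using (Fin; zero; suc)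
open import Data.Integer.Base as ℤ using (ℤ; -[1+_])
import Data.Fin.Properties as Fin
import Data.Integer.Properties as ℤ
open import Data.List.Base as List using (List; []; _∷_)
import Data.List.Properties as List
open import Data.List.Membership.Propositional using () renaming (_∈_ to _∈ˡ_; find to find∈)
import Data.List.Membership.Propositional.Properties as List
open import Data.List.Membership.DecPropositional using () renaming (_∈?_ to ∈-dec)
open import Data.List.Relation.Unary.All as All using ([]; _∷_)
open import Data.List.Relation.Unary.Any as Any using (here; there)
import Data.List.Relation.Unary.All.Properties as All
open import Data.List.Relation.Binary.Pointwise as Pointwiseˡ using ([]; _∷_)
import Data.List.Relation.Unary.Linked.Properties as Linked
import Data.List.Relation.Unary.Linked as Linked
open import Data.Maybe.Base as Maybe using (Maybe; just; nothing; maybe′)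
open import Data.Nat.Base as ℕ using (ℕ; zero; suc; _≤_; _<_)
import Data.Nat.Properties as ℕ
open import Data.Product.Base using (Σ-syntax; ∃; ∃-syntax; ∃₂; _,_; proj₁; proj₂; map₁; map₂)
open import Data.Rational.Base as ℚ using (ℚ; 0ℚ; 1ℚ)
import Data.Rational.Properties as ℚ
open import Data.Sum.Base as Sum using (_⊎_; inj₁; inj₂; [_,_]′)
open import Data.Unit.Base using (⊤; tt)
open import Data.Vec.Base as Vec using (Vec; []; _∷_; _++_; lookup)
import Data.Vec.Properties as Vec
open import Data.Vec.Relation.Binary.Pointwise.Inductive using ([]; _∷_)
open import Function.Base using (id; _∘_; const)
open import Function.Bundles using (Injection; _↣_; _⇔_; mk⇔; module Equivalence; mk↣)
open import Function.Definitions using (Injective)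
open import Relation.Binary.Bundles using (Setoid)
open import Relation.Binary.Definitions using (tri<; tri≈; tri>)
open import Relation.Binary.PropositionalEquality as ≡ using (_≡_; _≢_; refl)
open import Relation.Nullary.Decidable.Core using (Dec; yes; no; _⊎-dec_; ¬?; decidable-stable)
open import Relation.Nullary.Negation.Core using (contradiction)
open import Relation.Unary using (Pred)

open Equivalence using (to; from)

-- About an arbitrary model only the sentences true in 𝓖 are known. The coordinate projections,
-- which make every fact about the H_I obvious in 𝓖, are no symbols of the language, so they serve
-- only to verify such sentences; beyond that point the argument rests on the group and lattice
-- laws, properness of inclusions, purity and divisibility. Quantifier elimination stays semantic: a
-- formula is assigned a finite list of atoms instead of an equivalent formula. That agreement on
-- the atoms gives agreement on the formula is used within one model for the dichotomy, between a
-- model and an extension for the rank, and between realisations of two types for ω-stability. The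
-- recurring obstacle is that the whole model is the empty intersection of cosets but not itself a
-- coset of an H_I. Hence intersections are formed over nonempty lists, the empty one is treated
-- apart, and avoidance of cosets is proved for affine sets in general.

infixr 7 _∪_ _∩_
infix 4 _∈?_ _⊆_ _⊈_

-- Finite index sets

_∈?_ : ∀ i (I : FinSubset) → Dec (i ∈ I)
i ∈? (xs , _) = ∈-dec ℕ._≟_ i xs

_⊆_ _⊈_ : FinSubset → FinSubset → Set
I ⊆ J = ∀ {i} → i ∈ I → i ∈ J
I ⊈ J = ∃[ i ] (i ∈ I × ¬ (i ∈ J))

initial : ℕ → FinSubset
initial n = List.upTo n , Linked.applyUpTo⁺₂ id n ℕ.n<1+n

filter : {P : Pred ℕ 0ℓ} → (∀ i → Dec (P i)) → FinSubset → FinSubset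
filter P? (xs , lnk) = List.filter P? xs , Linked.filter⁺ P? ℕ.<-trans lnk

∅ : FinSubset
∅ = [] , Linked.[]

strictBound : FinSubset → ℕ
strictBound (xs , _) = List.foldr (ℕ._⊔_ ∘ suc) 0 xs

<-strictBound : ∀ I {i} → i ∈ I → i < strictBound I
<-strictBound (x ∷ xs , _)   (here refl) = ℕ.m≤m⊔n (suc x) (List.foldr (ℕ._⊔_ ∘ suc) 0 xs)
<-strictBound (x ∷ xs , lnk) (there i∈)  =
  ℕ.≤-trans (<-strictBound (xs , Linked.tail lnk) i∈) (ℕ.m≤n⊔m (suc x) (strictBound (xs , Linked.tail lnk)))

-- Both filter an increasing list, so that sortedness is inherited; for the union this is an initial
-- segment of ℕ containing both sets.
_∪_ _∩_ : FinSubset → FinSubset → FinSubset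
I ∪ J = filter (λ i → (i ∈? I) ⊎-dec (i ∈? J)) (initial (strictBound I ℕ.⊔ strictBound J))
I ∩ J = filter (_∈? J) I

∈-∪⁺ : ∀ I J {i} → i ∈ I ⊎ i ∈ J → i ∈ I ∪ J
∈-∪⁺ I J p = List.∈-filter⁺ (λ i → (i ∈? I) ⊎-dec (i ∈? J)) (List.∈-upTo⁺ (i<bound p)) p
  where
  i<bound : ∀ {i} → i ∈ I ⊎ i ∈ J → i < strictBound I ℕ.⊔ strictBound J
  i<bound (inj₁ i∈I) = ℕ.≤-trans (<-strictBound I i∈I) (ℕ.m≤m⊔n _ _)
  i<bound (inj₂ i∈J) = ℕ.≤-trans (<-strictBound J i∈J) (ℕ.m≤n⊔m _ _)

∈-∪⁻ : ∀ I J {i} → i ∈ I ∪ J → i ∈ I ⊎ i ∈ J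
∈-∪⁻ I J i∈ = proj₂ (List.∈-filter⁻ (λ i → (i ∈? I) ⊎-dec (i ∈? J))
  {xs = List.upTo (strictBound I ℕ.⊔ strictBound J)} i∈)

∈-∩⁺ : ∀ I J {i} → i ∈ I → i ∈ J → i ∈ I ∩ J
∈-∩⁺ I J = List.∈-filter⁺ (_∈? J)

∈-∩⁻ : ∀ I J {i} → i ∈ I ∩ J → i ∈ I × i ∈ J
∈-∩⁻ I J = List.∈-filter⁻ (_∈? J) {xs = proj₁ I}

∣_∣ᶠ : FinSubset → ℕ
∣ xs , _ ∣ᶠ = List.length xs

∩-shrinks : ∀ I J → I ⊈ J → ∣ I ∩ J ∣ᶠ < ∣ I ∣ᶠ
∩-shrinks (xs , _) J (i , i∈I , i∉J) =
  List.filter-notAll (_∈? J) xs (Any.map (λ { refl → i∉J }) i∈I)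

⊆-or-⊈ : ∀ I J → I ⊆ J ⊎ I ⊈ J
⊆-or-⊈ (xs , _) J with All.all? (_∈? J) xs
... | yes all = inj₁ (All.lookup all)
... | no ¬all with i , i∈ , i∉ ← find∈ (All.¬All⇒Any¬ (_∈? J) xs ¬all) = inj₂ (i , i∈ , i∉)

-- Transfer from 𝓖 to the models of its theory

Tm : ℕ → Set
Tm = Term 𝓛

Fm : ℕ → Set
Fm = Formula 𝓛

infixl 9 _+′_
infixr 10 _×′_
infixr 5 _⇒′_

0′ : ∀ {n} → Tm n
0′ = fun 0# []

_+′_ : ∀ {n} → Tm n → Tm n → Tm n
s +′ t = fun +# (s ∷ t ∷ [])

-′_ : ∀ {n} → Tm n → Tm n
-′ t = fun -# (t ∷ [])

_×′_ : ∀ {n} → ℕ → Tm n → Tm n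
zero  ×′ t = 0′
suc n ×′ t = t +′ (n ×′ t)

H′ : ∀ {n} → FinSubset → Tm n → Fm n
H′ I t = rel (H# I) (t ∷ [])

_⇒′_ : ∀ {n} → Fm n → Fm n → Fm n
φ ⇒′ ψ = ¬' (φ ∧' ¬' ψ)

closure : ∀ n → Fm n → Fm 0
closure zero    φ = φ
closure (suc n) φ = closure n (¬' ex' (¬' φ))

-- Multiples in ℚ and elements of 𝓖

module ×ℚ = Algebra.Properties.Semiring.Mult (Ring.semiring ℚ.+-*-ring)

×1-pos : ∀ n → ℚ.Positive (suc n ×ℚ.× 1ℚ)
×1-pos zero    = _
×1-pos (suc n) = ℚ.pos+pos⇒pos 1ℚ (suc n ×ℚ.× 1ℚ) {{×1-pos n}}

×-as-* : ∀ n q → n ×ℚ.× q ≡ (n ×ℚ.× 1ℚ) ℚ.* q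
×-as-* n q = ≡.trans (≡.cong (n ×ℚ.×_) (≡.sym (ℚ.*-identityˡ q))) (≡.sym (×ℚ.×-assoc-* n 1ℚ q))

×1-nonZero : ∀ n → ℚ.NonZero (suc n ×ℚ.× 1ℚ)
×1-nonZero n = ℚ.pos⇒nonZero (suc n ×ℚ.× 1ℚ) {{×1-pos n}}

invℚ : ℕ → ℚ
invℚ n = (ℚ.1/ (suc n ×ℚ.× 1ℚ)) {{×1-nonZero n}}

×-invℚ : ∀ n q → suc n ×ℚ.× (invℚ n ℚ.* q) ≡ q
×-invℚ n q = begin
  suc n ×ℚ.× (invℚ n ℚ.* q)           ≡⟨ ×-as-* (suc n) _ ⟩
  (suc n ×ℚ.× 1ℚ) ℚ.* (invℚ n ℚ.* q)  ≡⟨ ℚ.*-assoc (suc n ×ℚ.× 1ℚ) (invℚ n) q ⟨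
  ((suc n ×ℚ.× 1ℚ) ℚ.* invℚ n) ℚ.* q  ≡⟨ ≡.cong (ℚ._* q) (ℚ.*-inverseʳ (suc n ×ℚ.× 1ℚ) {{×1-nonZero n}}) ⟩
  1ℚ ℚ.* q                            ≡⟨ ℚ.*-identityˡ q ⟩
  q                                   ∎
  where open ≡.≡-Reasoning

×-torsionFree : ∀ n q → suc n ×ℚ.× q ≡ 0ℚ → q ≡ 0ℚ
×-torsionFree n q nq≡0 = begin
  q                                   ≡⟨ ×-invℚ n q ⟨
  suc n ×ℚ.× (invℚ n ℚ.* q)           ≡⟨ ×ℚ.×-comm-* (suc n) (invℚ n) q ⟨
  invℚ n ℚ.* (suc n ×ℚ.× q)           ≡⟨ ≡.cong (invℚ n ℚ.*_) nq≡0 ⟩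
  invℚ n ℚ.* 0ℚ                       ≡⟨ ℚ.*-zeroʳ (invℚ n) ⟩
  0ℚ                                  ∎
  where open ≡.≡-Reasoning

coord-×′ : ∀ {m} n (t : Tm m) v i → coord (eval 𝓖 v (n ×′ t)) i ≡ n ×ℚ.× coord (eval 𝓖 v t) i
coord-×′ zero    t v i = refl
coord-×′ (suc n) t v i = ≡.cong (coord (eval 𝓖 v t) i ℚ.+_) (coord-×′ n t v i)

divideᴳ : ℕ → ℚ^⟨ω⟩ → ℚ^⟨ω⟩
divideᴳ n g = record
  { coord   = λ i → invℚ n ℚ.* coord g i
  ; bound   = bound g
  ; support = λ i le → ≡.trans (≡.cong (invℚ n ℚ.*_) (support g i le)) (ℚ.*-zeroʳ (invℚ n))
  }

-- The coordinate projection onto H_I. It reaches other models only through first-order consequences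
-- such as `∈H-split` and `∈H-proper`.
mask : FinSubset → ℚ^⟨ω⟩ → ℚ^⟨ω⟩
mask I g = record
  { coord   = λ i → maskedCoord i (i ∈? I)
  ; bound   = bound g
  ; support = λ i le → vanish i le (i ∈? I)
  }
  where
  maskedCoord : ∀ i → Dec (i ∈ I) → ℚ
  maskedCoord i (yes _) = coord g i
  maskedCoord i (no  _) = 0ℚ

  vanish : ∀ i → bound g ≤ i → ∀ d → maskedCoord i d ≡ 0ℚ
  vanish i le (yes _) = support g i le
  vanish i le (no  _) = refl

mask-∈ : ∀ I g {i} → i ∈ I → coord (mask I g) i ≡ coord g i
mask-∈ I g {i} i∈I with i ∈? I
... | yes _  = refl
... | no i∉I = contradiction i∈I i∉I

mask-∉ : ∀ I g {i} → ¬ (i ∈ I) → coord (mask I g) i ≡ 0ℚ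
mask-∉ I g {i} i∉I with i ∈? I
... | yes i∈I = contradiction i∈I i∉I
... | no _    = refl

fromCoords : ℕ → (ℕ → ℚ) → ℚ^⟨ω⟩
fromCoords n f = record
  { coord   = λ i → cut i (i ℕ.<? n)
  ; bound   = n
  ; support = λ i n≤i → vanish i n≤i (i ℕ.<? n)
  }
  where
  cut : ∀ i → Dec (i < n) → ℚ
  cut i (yes _) = f i
  cut i (no  _) = 0ℚ

  vanish : ∀ i → n ≤ i → ∀ d → cut i d ≡ 0ℚ
  vanish i n≤i (yes i<n) = contradiction n≤i (ℕ.<⇒≱ i<n)
  vanish i n≤i (no _)    = refl

fromCoords-< : ∀ n f {i} → i < n → coord (fromCoords n f) i ≡ f i
fromCoords-< n f {i} i<n with i ℕ.<? n
... | yes _  = refl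
... | no i≮n = contradiction i<n i≮n

module Classical (em : ∀ ℓ → ExcludedMiddle ℓ) where

  dne : ∀ {ℓ} {P : Set ℓ} → ¬ ¬ P → P
  dne {ℓ} = decidable-stable (em ℓ)

  ⇒′-intro : ∀ (M : Structure 𝓛) {n} (φ ψ : Fm n) v →
             (M ⊨ φ [ v ] → M ⊨ ψ [ v ]) → M ⊨ φ ⇒′ ψ [ v ]
  ⇒′-intro M φ ψ v f (p , ¬q) = ¬q (f p)

  ⇒′-elim : ∀ (M : Structure 𝓛) {n} (φ ψ : Fm n) v →
            M ⊨ φ ⇒′ ψ [ v ] → M ⊨ φ [ v ] → M ⊨ ψ [ v ]
  ⇒′-elim M φ ψ v f p = dne λ ¬q → f (p , ¬q)

  closure-intro : ∀ (M : Structure 𝓛) n (φ : Fm n) →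
                  (∀ v → M ⊨ φ [ v ]) → M ⊨ closure n φ [ [] ]
  closure-intro M zero    φ f = f []
  closure-intro M (suc n) φ f = closure-intro M n _ λ { v (x , ¬p) → ¬p (f (x ∷ v)) }

  closure-elim : ∀ (M : Structure 𝓛) n (φ : Fm n) →
                 M ⊨ closure n φ [ [] ] → ∀ v → M ⊨ φ [ v ]
  closure-elim M zero    φ p []      = p
  closure-elim M (suc n) φ p (x ∷ v) = dne λ ¬q → closure-elim M n _ p v (x , ¬q)

  module Axioms (M : Structure 𝓛) (𝓖≡M : 𝓖 ≡ₑ M) where
    open Structure M public using (Carrier; _≈_; domain; ⟦fun⟧; ⟦rel⟧; fun-cong; rel-resp)

    -- Elementary equivalence compares sentences only, so a property with free variables travels
    -- through its universal closure.
    transfer : ∀ n (φ : Fm n) → (∀ v → 𝓖 ⊨ φ [ v ]) → ∀ v → M ⊨ φ [ v ]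
    transfer n φ p = closure-elim M n φ (to (𝓖≡M (closure n φ)) (closure-intro 𝓖 n φ p))

    transfer-⇒ : ∀ n (φ ψ : Fm n) → (∀ v → 𝓖 ⊨ φ [ v ] → 𝓖 ⊨ ψ [ v ]) →
                 ∀ v → M ⊨ φ [ v ] → M ⊨ ψ [ v ]
    transfer-⇒ n φ ψ p v = ⇒′-elim M φ ψ v (transfer n (φ ⇒′ ψ) (λ u → ⇒′-intro 𝓖 φ ψ u (p u)) v)

    private
      x₀ : ∀ {n} → Tm (suc n)
      x₀ = var zero
      x₁ : ∀ {n} → Tm (suc (suc n))
      x₁ = var (suc zero)
      x₂ : Tm 3
      x₂ = var (suc (suc zero))

    abelianGroup : AbelianGroup 0ℓ 0ℓ
    abelianGroup = record
      { Carrier = Carrier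
      ; _≈_ = _≈_
      ; _∙_ = λ x y → ⟦fun⟧ +# (x ∷ y ∷ [])
      ; ε = ⟦fun⟧ 0# []
      ; _⁻¹ = λ x → ⟦fun⟧ -# (x ∷ [])
      ; isAbelianGroup = record
        { isGroup = record
          { isMonoid = record
            { isSemigroup = record
              { isMagma = record
                { isEquivalence = Setoid.isEquivalence domain
                ; ∙-cong = λ p q → fun-cong +# (p ∷ q ∷ [])
                }
              ; assoc = λ x y z → transfer 3 ((x₀ +′ x₁) +′ x₂ ≐ x₀ +′ (x₁ +′ x₂))
                  (λ { (x ∷ y ∷ z ∷ []) i → ℚ.+-assoc (coord x i) (coord y i) (coord z i) }) (x ∷ y ∷ z ∷ [])
              }
            ; identity
                = (λ x → transfer 1 (0′ +′ x₀ ≐ x₀) (λ { (x ∷ []) i → ℚ.+-identityˡ (coord x i) }) (x ∷ []))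
                , (λ x → transfer 1 (x₀ +′ 0′ ≐ x₀) (λ { (x ∷ []) i → ℚ.+-identityʳ (coord x i) }) (x ∷ []))
            }
          ; inverse
              = (λ x → transfer 1 (-′ x₀ +′ x₀ ≐ 0′) (λ { (x ∷ []) i → ℚ.+-inverseˡ (coord x i) }) (x ∷ []))
              , (λ x → transfer 1 (x₀ +′ -′ x₀ ≐ 0′) (λ { (x ∷ []) i → ℚ.+-inverseʳ (coord x i) }) (x ∷ []))
          ; ⁻¹-cong = λ p → fun-cong -# (p ∷ [])
          }
        ; comm = λ x y → transfer 2 (x₀ +′ x₁ ≐ x₁ +′ x₀)
            (λ { (x ∷ y ∷ []) i → ℚ.+-comm (coord x i) (coord y i) }) (x ∷ y ∷ [])
        }
      }

    open AbelianGroup abelianGroup public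
      using (setoid; trans; sym; reflexive; monoid; commutativeMonoid; commutativeSemigroup; inverseˡ; inverseʳ; _-_)
      renaming (_∙_ to _+_; ε to 𝟘; _⁻¹ to -_; refl to ≈-refl; ∙-cong to +-cong; ∙-congˡ to +-congˡ; ∙-congʳ to +-congʳ;
        ⁻¹-cong to -‿cong; assoc to +-assoc; comm to +-comm; identityˡ to +-identityˡ; identityʳ to +-identityʳ)
    open Algebra.Properties.Monoid.Mult monoid public renaming (_×_ to _×ⁿ_) using (×-congʳ; ×-homo-+)

    infix 4 _∈H_
    _∈H_ : Carrier → FinSubset → Set
    x ∈H I = ⟦rel⟧ (H# I) (x ∷ [])

    ∈H-resp : ∀ I {x y} → x ≈ y → x ∈H I → y ∈H I
    ∈H-resp I p = rel-resp (H# I) (p ∷ [])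

    eval-×′ : ∀ {m} n (t : Tm m) v → eval M v (n ×′ t) ≡ n ×ⁿ eval M v t
    eval-×′ zero    t v = refl
    eval-×′ (suc n) t v = ≡.cong (eval M v t +_) (eval-×′ n t v)

    0∈H : ∀ I → 𝟘 ∈H I
    0∈H I = transfer 0 (H′ I 0′) (λ { [] i _ → refl }) []

    +-∈H : ∀ I {x y} → x ∈H I → y ∈H I → x + y ∈H I
    +-∈H I {x} {y} p q = transfer-⇒ 2 (H′ I x₀ ∧' H′ I x₁) (H′ I (x₀ +′ x₁))
      (λ { (x ∷ y ∷ []) (p , q) i i∉ → ≡.cong₂ ℚ._+_ (p i i∉) (q i i∉) }) (x ∷ y ∷ []) (p , q)

    -‿∈H : ∀ I {x} → x ∈H I → - x ∈H I
    -‿∈H I {x} = transfer-⇒ 1 (H′ I x₀) (H′ I (-′ x₀))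
      (λ { (x ∷ []) p i i∉ → ≡.cong ℚ.-_ (p i i∉) }) (x ∷ [])

    ∈H-∅ : ∀ {x} → x ∈H ∅ → x ≈ 𝟘
    ∈H-∅ {x} = transfer-⇒ 1 (H′ ∅ x₀) (x₀ ≐ 0′) (λ { (x ∷ []) p i → p i λ () }) (x ∷ [])

    -- With a variable `K` in place of `I ∩ J`, one transferred sentence also yields monotonicity
    -- and the distributive law.
    ∈H-∩ : ∀ I J K → (∀ {i} → i ∈ I → i ∈ J → i ∈ K) → ∀ {x} → x ∈H I → x ∈H J → x ∈H K
    ∈H-∩ I J K I∩J⊆K {x} p q = transfer-⇒ 1 (H′ I x₀ ∧' H′ J x₀) (H′ K x₀) holds (x ∷ []) (p , q)
      where
      holds : ∀ v → 𝓖 ⊨ H′ I x₀ ∧' H′ J x₀ [ v ] → 𝓖 ⊨ H′ K x₀ [ v ]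
      holds (x ∷ []) (p , q) i i∉K with i ∈? I
      ... | no i∉I  = p i i∉I
      ... | yes i∈I = q i λ i∈J → i∉K (I∩J⊆K i∈I i∈J)

    ∈H-⊆ : ∀ I J → I ⊆ J → ∀ {x} → x ∈H I → x ∈H J
    ∈H-⊆ I J I⊆J p = ∈H-∩ I I J (λ i∈ _ → I⊆J i∈) p p

    -- In 𝓖 the witness is the part of `x` supported on `I`; what remains lives on indices of `K`
    -- outside `I`, hence in `J`.
    ∈H-split : ∀ I J K → (∀ {i} → i ∈ K → i ∈ I ⊎ i ∈ J) → ∀ {x} → x ∈H K →
               ∃[ h ] (h ∈H I × x - h ∈H J)
    ∈H-split I J K K⊆I∪J {x} = transfer-⇒ 1 (H′ K x₀) (ex' (H′ I x₀ ∧' H′ J (x₁ +′ -′ x₀))) holds (x ∷ [])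
      where
      holds : ∀ v → 𝓖 ⊨ H′ K x₀ [ v ] → 𝓖 ⊨ ex' (H′ I x₀ ∧' H′ J (x₁ +′ -′ x₀)) [ v ]
      holds (x ∷ []) p = mask I x , (λ i → mask-∉ I x) , rest
        where
        rest : ∀ i → ¬ (i ∈ J) → coord x i ℚ.+ ℚ.- coord (mask I x) i ≡ 0ℚ
        rest i i∉J with i ∈? I
        ... | yes i∈I = ℚ.+-inverseʳ (coord x i)
        ... | no i∉I  = ≡.cong (ℚ._+ 0ℚ) (p i λ i∈K → [ i∉I , i∉J ]′ (K⊆I∪J i∈K))

    ∈H-proper : ∀ I J → I ⊈ J → ∃[ h ] (h ∈H I × ¬ (h ∈H J))
    ∈H-proper I J (j , j∈I , j∉J) =
      transfer 0 (ex' (H′ I x₀ ∧' ¬' H′ J x₀)) (λ { [] → h , (λ i → mask-∉ I _) , h∉J }) []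
      where
      h = mask I (fromCoords (suc j) (const 1ℚ))
      h∉J : ¬ H J h
      h∉J p with () ← ≡.trans (≡.sym (≡.trans (mask-∈ I _ j∈I) (fromCoords-< (suc j) (const 1ℚ) ℕ.≤-refl))) (p j j∉J)

    -- The quotients by the H_I are torsion-free. Together with `divisible` this stands in for a
    -- scalar multiplication by ℚ.
    ∈H-pure : ∀ I n {x} → suc n ×ⁿ x ∈H I → x ∈H I
    ∈H-pure I n {x} p = transfer-⇒ 1 (H′ I (suc n ×′ x₀)) (H′ I x₀) holds (x ∷ [])
      (≡.subst (_∈H I) (≡.sym (eval-×′ (suc n) x₀ (x ∷ []))) p)
      where
      holds : ∀ v → 𝓖 ⊨ H′ I (suc n ×′ x₀) [ v ] → 𝓖 ⊨ H′ I x₀ [ v ]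
      holds (x ∷ []) p i i∉I = ×-torsionFree n _
        (≡.trans (≡.sym (coord-×′ (suc n) (x₀ {0}) (x ∷ []) i)) (p i i∉I))

    divisible : ∀ n x → ∃[ y ] suc n ×ⁿ y ≈ x
    divisible n x = map₂ (trans (reflexive (≡.sym (eval-×′ (suc n) x₀ _))))
      (transfer 1 (ex' (suc n ×′ x₀ ≐ x₁)) holds (x ∷ []))
      where
      holds : ∀ v → 𝓖 ⊨ ex' (suc n ×′ x₀ ≐ x₁) [ v ]
      holds (x ∷ []) = divideᴳ n x , λ i →
        ≡.trans (coord-×′ (suc n) (x₀ {1}) (divideᴳ n x ∷ x ∷ []) i) (×-invℚ n (coord x i))

  -- Cosets of the H_I in a model

  -- The first argument is the base case, so the list is never empty: an empty intersection would
  -- have to be the whole model, which is no H_I.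
  ⋂ : FinSubset → List FinSubset → FinSubset
  ⋂ = List.foldr _∩_

  module Model (M : Structure 𝓛) (𝓖≡M : 𝓖 ≡ₑ M) where
    open Axioms M 𝓖≡M public
    open import Relation.Binary.Reasoning.Setoid setoid
    open Algebra.Properties.AbelianGroup abelianGroup
      using (⁻¹-involutive; ⁻¹-∙-comm; ⁻¹-anti-homo‿-; ε⁻¹≈ε; xyx⁻¹≈y; x≈y⇒x∙y⁻¹≈ε)
    open Algebra.Properties.CommutativeSemigroup commutativeSemigroup using (interchange; xy∙z≈xz∙y)
    open Algebra.Properties.CommutativeMonoid.Mult commutativeMonoid using (×-distrib-+)

    +-interchange-minus : ∀ x x′ y y′ → (x + x′) - (y + y′) ≈ (x - y) + (x′ - y′)
    +-interchange-minus x x′ y y′ = begin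
      (x + x′) - (y + y′)        ≈⟨ +-congˡ (⁻¹-∙-comm y y′) ⟨
      (x + x′) + (- y + - y′)    ≈⟨ interchange x x′ (- y) (- y′) ⟩
      (x - y) + (x′ - y′)        ∎

    [x+y]-[x+z]≈y-z : ∀ x y z → (x + y) - (x + z) ≈ y - z
    [x+y]-[x+z]≈y-z x y z = begin
      (x + y) - (x + z)    ≈⟨ +-interchange-minus x y x z ⟩
      (x - x) + (y - z)    ≈⟨ +-congʳ (inverseʳ x) ⟩
      𝟘 + (y - z)          ≈⟨ +-identityˡ _ ⟩
      y - z                ∎

    [x-y]+[y-z]≈x-z : ∀ x y z → (x - y) + (y - z) ≈ x - z
    [x-y]+[y-z]≈x-z x y z = begin
      (x - y) + (y - z)      ≈⟨ +-assoc x (- y) (y - z) ⟩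
      x + (- y + (y - z))    ≈⟨ +-congˡ (+-assoc (- y) y (- z)) ⟨
      x + ((- y + y) - z)    ≈⟨ +-congˡ (+-congʳ (inverseˡ y)) ⟩
      x + (𝟘 - z)            ≈⟨ +-congˡ (+-identityˡ (- z)) ⟩
      x - z                  ∎

    infixr 8 _•_
    -- Integers are enough as scalars, since a rational linear condition can be cleared of
    -- denominators.
    _•_ : ℤ → Carrier → Carrier
    (ℤ.+ n)  • x = n ×ⁿ x
    -[1+ n ] • x = - (suc n ×ⁿ x)

    •-cong : ∀ k {x y} → x ≈ y → k • x ≈ k • y
    •-cong (ℤ.+ n)  p = ×-congʳ n p
    •-cong -[1+ n ] p = -‿cong (×-congʳ (suc n) p)

    ⊖-• : ∀ m n x → (m ℤ.⊖ n) • x ≈ m ×ⁿ x - n ×ⁿ x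
    ⊖-• m zero x = begin
      m ×ⁿ x        ≈⟨ +-identityʳ _ ⟨
      m ×ⁿ x + 𝟘    ≈⟨ +-congˡ ε⁻¹≈ε ⟨
      m ×ⁿ x - 𝟘    ∎
    ⊖-• zero (suc n) x = sym (+-identityˡ _)
    ⊖-• (suc m) (suc n) x = begin
      (suc m ℤ.⊖ suc n) • x         ≡⟨ ≡.cong (_• x) (ℤ.[1+m]⊖[1+n]≡m⊖n m n) ⟩
      (m ℤ.⊖ n) • x                 ≈⟨ ⊖-• m n x ⟩
      m ×ⁿ x - n ×ⁿ x               ≈⟨ [x+y]-[x+z]≈y-z x _ _ ⟨
      suc m ×ⁿ x - suc n ×ⁿ x       ∎

    •-distribʳ : ∀ k l x → (k ℤ.+ l) • x ≈ k • x + l • x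
    •-distribʳ (ℤ.+ m)  (ℤ.+ n)  x = ×-homo-+ x m n
    •-distribʳ (ℤ.+ m)  -[1+ n ] x = ⊖-• m (suc n) x
    •-distribʳ -[1+ m ] (ℤ.+ n)  x = trans (⊖-• n (suc m) x) (+-comm _ _)
    •-distribʳ -[1+ m ] -[1+ n ] x = begin
      - (suc (suc (m ℕ.+ n)) ×ⁿ x)          ≡⟨ ≡.cong (λ k → - (suc k ×ⁿ x)) (ℕ.+-suc m n) ⟨
      - ((suc m ℕ.+ suc n) ×ⁿ x)            ≈⟨ -‿cong (×-homo-+ x (suc m) (suc n)) ⟩
      - (suc m ×ⁿ x + suc n ×ⁿ x)           ≈⟨ ⁻¹-∙-comm _ _ ⟨
      - (suc m ×ⁿ x) + - (suc n ×ⁿ x)       ∎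

    •-distribˡ : ∀ k x y → k • (x + y) ≈ k • x + k • y
    •-distribˡ (ℤ.+ n)  x y = ×-distrib-+ x y n
    •-distribˡ -[1+ n ] x y = trans (-‿cong (×-distrib-+ x y (suc n))) (sym (⁻¹-∙-comm _ _))

    neg-• : ∀ k x → (ℤ.- k) • x ≈ - (k • x)
    neg-• (ℤ.+ zero)  x = sym ε⁻¹≈ε
    neg-• (ℤ.+ suc n) x = ≈-refl
    neg-• -[1+ n ]    x = sym (⁻¹-involutive _)

    *-•-pos : ∀ m l x → (ℤ.+ m ℤ.* l) • x ≈ m ×ⁿ (l • x)
    *-•-pos zero    l x = ≈-refl
    *-•-pos (suc m) l x = begin
      (ℤ.+ suc m ℤ.* l) • x         ≡⟨ ≡.cong (_• x) (ℤ.suc-* (ℤ.+ m) l) ⟩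
      (l ℤ.+ ℤ.+ m ℤ.* l) • x       ≈⟨ •-distribʳ l (ℤ.+ m ℤ.* l) x ⟩
      l • x + (ℤ.+ m ℤ.* l) • x     ≈⟨ +-congˡ (*-•-pos m l x) ⟩
      suc m ×ⁿ (l • x)              ∎

    *-• : ∀ k l x → (k ℤ.* l) • x ≈ k • l • x
    *-• (ℤ.+ m)  l x = *-•-pos m l x
    *-• -[1+ m ] l x = begin
      (-[1+ m ] ℤ.* l) • x            ≡⟨ ≡.cong (_• x) (ℤ.neg-distribˡ-* (ℤ.+ suc m) l) ⟨
      (ℤ.- (ℤ.+ suc m ℤ.* l)) • x     ≈⟨ neg-• (ℤ.+ suc m ℤ.* l) x ⟩
      - ((ℤ.+ suc m ℤ.* l) • x)       ≈⟨ -‿cong (*-•-pos (suc m) l x) ⟩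
      - (suc m ×ⁿ (l • x))            ∎

    •-comm : ∀ k l x → k • l • x ≈ l • k • x
    •-comm k l x = begin
      k • l • x          ≈⟨ *-• k l x ⟨
      (k ℤ.* l) • x      ≡⟨ ≡.cong (_• x) (ℤ.*-comm k l) ⟩
      (l ℤ.* k) • x      ≈⟨ *-• l k x ⟩
      l • k • x          ∎

    1•x≈x : ∀ x → ℤ.1ℤ • x ≈ x
    1•x≈x = +-identityʳ

    •-𝟘 : ∀ k → k • 𝟘 ≈ 𝟘
    •-𝟘 k = trans (sym (*-• k ℤ.0ℤ 𝟘)) (reflexive (≡.cong (_• 𝟘) (ℤ.*-zeroʳ k)))

    •-neg : ∀ k x → k • (- x) ≈ - (k • x)
    •-neg k x = begin
      k • (- x)                      ≈⟨ •-cong k (-‿cong (1•x≈x x)) ⟨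
      k • ℤ.-1ℤ • x                  ≈⟨ •-comm k ℤ.-1ℤ x ⟩
      ℤ.-1ℤ • k • x                  ≈⟨ -‿cong (1•x≈x (k • x)) ⟩
      - (k • x)                      ∎

    ×-∈H : ∀ I n {x} → x ∈H I → n ×ⁿ x ∈H I
    ×-∈H I zero    p = 0∈H I
    ×-∈H I (suc n) p = +-∈H I p (×-∈H I n p)

    •-∈H : ∀ I k {x} → x ∈H I → k • x ∈H I
    •-∈H I (ℤ.+ n)  p = ×-∈H I n p
    •-∈H I -[1+ n ] p = -‿∈H I (×-∈H I (suc n) p)

    •-∈H⁻ : ∀ I k → k ≢ ℤ.0ℤ → ∀ {x} → k • x ∈H I → x ∈H I
    •-∈H⁻ I (ℤ.+ zero)    k≢0 p = contradiction refl k≢0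
    •-∈H⁻ I (ℤ.+ (suc n)) k≢0 p = ∈H-pure I n p
    •-∈H⁻ I -[1+ n ]      k≢0 p = ∈H-pure I n (∈H-resp I (⁻¹-involutive _) (-‿∈H I p))

    quotient : ∀ k → k ≢ ℤ.0ℤ → ∀ x → ∃[ y ] k • y ≈ x
    quotient (ℤ.+ zero)    k≢0 x = contradiction refl k≢0
    quotient (ℤ.+ (suc n)) k≢0 x = divisible n x
    quotient -[1+ n ]      k≢0 x with y , p ← divisible n (- x) = y , trans (-‿cong p) (⁻¹-involutive x)

    infix 4 _~[_]_
    _~[_]_ : Carrier → FinSubset → Carrier → Set
    x ~[ I ] y = x - y ∈H I

    ≈⇒~ : ∀ I {x y} → x ≈ y → x ~[ I ] y
    ≈⇒~ I p = ∈H-resp I (sym (x≈y⇒x∙y⁻¹≈ε p)) (0∈H I)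

    ~-sym : ∀ I {x y} → x ~[ I ] y → y ~[ I ] x
    ~-sym I {x} {y} p = ∈H-resp I (⁻¹-anti-homo‿- x y) (-‿∈H I p)

    ~-trans : ∀ I {x y z} → x ~[ I ] y → y ~[ I ] z → x ~[ I ] z
    ~-trans I p q = ∈H-resp I ([x-y]+[y-z]≈x-z _ _ _) (+-∈H I p q)

    ~-resp : ∀ I {x x′ y y′} → x ≈ x′ → y ≈ y′ → x ~[ I ] y → x′ ~[ I ] y′
    ~-resp I p q = ∈H-resp I (+-cong p (-‿cong q))

    ~-⊆ : ∀ I J → I ⊆ J → ∀ {x y} → x ~[ I ] y → x ~[ J ] y
    ~-⊆ I J I⊆J = ∈H-⊆ I J I⊆J

    ~-∪ˡ : ∀ I J {x y} → x ~[ I ] y → x ~[ I ∪ J ] y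
    ~-∪ˡ I J = ~-⊆ I (I ∪ J) (∈-∪⁺ I J ∘ inj₁)

    ~-∪ʳ : ∀ I J {x y} → x ~[ J ] y → x ~[ I ∪ J ] y
    ~-∪ʳ I J = ~-⊆ J (I ∪ J) (∈-∪⁺ I J ∘ inj₂)

    •-distribˡ-minus : ∀ k x y → k • (x - y) ≈ k • x - k • y
    •-distribˡ-minus k x y = trans (•-distribˡ k x (- y)) (+-congˡ (•-neg k y))

    ~-•⁺ : ∀ I k {x y} → x ~[ I ] y → k • x ~[ I ] k • y
    ~-•⁺ I k p = ∈H-resp I (•-distribˡ-minus k _ _) (•-∈H I k p)

    ~-•⁻ : ∀ I k → k ≢ ℤ.0ℤ → ∀ {x y} → k • x ~[ I ] k • y → x ~[ I ] y
    ~-•⁻ I k k≢0 p = •-∈H⁻ I k k≢0 (∈H-resp I (sym (•-distribˡ-minus k _ _)) p)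

    Coset : Set
    Coset = Carrier × FinSubset

    infix 4 _∈ᶜ_
    _∈ᶜ_ : Carrier → Coset → Set
    x ∈ᶜ (r , I) = x ~[ I ] r

    -- Union distributes over intersection of index sets, and intersections of index sets become
    -- intersections of subgroups.
    ∈H-⋂ : ∀ J I Is {x} → (∀ {I′} → I′ ∈ˡ (I ∷ Is) → x ∈H J ∪ I′) → x ∈H J ∪ ⋂ I Is
    ∈H-⋂ J I []        p = p (here refl)
    ∈H-⋂ J I (I′ ∷ Is) p = ∈H-∩ (J ∪ I′) (J ∪ ⋂ I Is) (J ∪ (I′ ∩ ⋂ I Is)) distrib
      (p (there (here refl))) (∈H-⋂ J I Is λ { (here q) → p (here q) ; (there q) → p (there (there q)) })
      where
      distrib : ∀ {i} → i ∈ J ∪ I′ → i ∈ J ∪ ⋂ I Is → i ∈ J ∪ (I′ ∩ ⋂ I Is)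
      distrib i∈ i∈′ with ∈-∪⁻ J I′ i∈ | ∈-∪⁻ J (⋂ I Is) i∈′
      ... | inj₁ i∈J | _        = ∈-∪⁺ J (I′ ∩ ⋂ I Is) (inj₁ i∈J)
      ... | inj₂ _   | inj₁ i∈J = ∈-∪⁺ J (I′ ∩ ⋂ I Is) (inj₁ i∈J)
      ... | inj₂ i∈I | inj₂ i∈⋂ = ∈-∪⁺ J (I′ ∩ ⋂ I Is) (inj₂ (∈-∩⁺ I′ (⋂ I Is) i∈I i∈⋂))

    ⋂-⊆ : ∀ I Is {I′} → I′ ∈ˡ (I ∷ Is) → ⋂ I Is ⊆ I′
    ⋂-⊆ I []       (here refl)         = id
    ⋂-⊆ I (J ∷ Is) (here refl)         = ⋂-⊆ I Is (here refl) ∘ proj₂ ∘ ∈-∩⁻ J (⋂ I Is)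
    ⋂-⊆ I (J ∷ Is) (there (here refl)) = proj₁ ∘ ∈-∩⁻ J (⋂ I Is)
    ⋂-⊆ I (J ∷ Is) (there (there p))   = ⋂-⊆ I Is (there p) ∘ proj₂ ∘ ∈-∩⁻ J (⋂ I Is)

    Compatible : List Coset → Set
    Compatible cs = ∀ {r I s J} → (r , I) ∈ˡ cs → (s , J) ∈ˡ cs → r ~[ I ∪ J ] s

    -- Pairwise compatibility suffices because the H_I form a distributive lattice.
    chineseRemainder : ∀ c cs → Compatible (c ∷ cs) → ∃[ z ] (∀ {d} → d ∈ˡ (c ∷ cs) → z ∈ᶜ d)
    chineseRemainder (r , I) [] _ = r , λ { (here refl) → ≈⇒~ I ≈-refl }
    -- `z` solves all the congruences except that of `d`, and `h` corrects it. Dropping the second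
    -- coset keeps the list nonempty.
    chineseRemainder c@(r , I) (d@(s , J) ∷ cs) compat = z - h , λ
        { (here refl)         → moved (here refl)
        ; (there (here refl)) → ∈H-resp J (xy∙z≈xz∙y z (- s) (- h)) z-s-h∈
        ; (there (there p))   → moved (there p)
        }
      where
      skip : ∀ {e} → e ∈ˡ (c ∷ cs) → e ∈ˡ (c ∷ d ∷ cs)
      skip (here p)  = here p
      skip (there p) = there (there p)
      solution : ∃[ z ] (∀ {e} → e ∈ˡ (c ∷ cs) → z ∈ᶜ e)
      solution = chineseRemainder c cs (λ p q → compat (skip p) (skip q))
      z = proj₁ solution
      z∈ : ∀ {e} → e ∈ˡ (c ∷ cs) → z ∈ᶜ e
      z∈ = proj₂ solution
      Is = List.map proj₂ cs
      -- Modulo each `J ∪ I′`, `z` agrees with `s` by way of a representative compatible with it;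
      -- distributivity merges these congruences.
      z~s : z - s ∈H J ∪ ⋂ I Is
      z~s = ∈H-⋂ J I Is λ {I′} I′∈ → let (e , e∈ , I′≡) = List.∈-map⁻ proj₂ {xs = c ∷ cs} I′∈ in
        ≡.subst (λ I′ → z ~[ J ∪ I′ ] s) (≡.sym I′≡)
          (~-trans (J ∪ proj₂ e) (~-∪ʳ J (proj₂ e) (z∈ e∈)) (~-sym (J ∪ proj₂ e) (compat (there (here refl)) (skip e∈))))
      -- Here `h` lies in the subgroup of every coset already met, so subtracting it stays in those
      -- cosets, while `z - s - h` lies in H_J, so it also enters `d`.
      split = ∈H-split (⋂ I Is) J (J ∪ ⋂ I Is) (Sum.swap ∘ ∈-∪⁻ J (⋂ I Is)) z~s
      h = proj₁ split
      z-s-h∈ = proj₂ (proj₂ split)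
      moved : ∀ {e} → e ∈ˡ (c ∷ cs) → z - h ∈ᶜ e
      moved {e} e∈ = ~-trans (proj₂ e) (∈H-⊆ (⋂ I Is) (proj₂ e) (⋂-⊆ I Is (List.∈-map⁺ proj₂ e∈))
        (∈H-resp (⋂ I Is) (sym (trans (xy∙z≈xz∙y z (- h) (- z)) (trans (+-congʳ (inverseʳ z)) (+-identityˡ (- h)))))
          (-‿∈H (⋂ I Is) (proj₁ (proj₂ split))))) (z∈ e∈)

    line : Carrier → Carrier → ℕ → Carrier
    line z w k = z + k ×ⁿ (w - z)

    line-difference : ∀ z w m k → line z w (m ℕ.+ k) - line z w k ≈ m ×ⁿ (w - z)
    line-difference z w m k = begin
      line z w (m ℕ.+ k) - line z w k    ≈⟨ [x+y]-[x+z]≈y-z z _ _ ⟩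
      (m ℕ.+ k) ×ⁿ d - k ×ⁿ d            ≈⟨ +-congʳ (×-homo-+ d m k) ⟩
      (m ×ⁿ d + k ×ⁿ d) - k ×ⁿ d         ≈⟨ +-assoc _ _ _ ⟩
      m ×ⁿ d + (k ×ⁿ d - k ×ⁿ d)         ≈⟨ +-congˡ (inverseʳ _) ⟩
      m ×ⁿ d + 𝟘                         ≈⟨ +-identityʳ _ ⟩
      m ×ⁿ d                             ∎
      where d = w - z

    line-0 : ∀ z w → line z w 0 ≈ z
    line-0 z w = +-identityʳ z

    -- The difference of the two points is a positive multiple of `w - z`, and purity removes the
    -- factor.
    twice-on-line : ∀ z w m k c → line z w (suc m ℕ.+ k) ∈ᶜ c → line z w k ∈ᶜ c → w ~[ proj₂ c ] z
    twice-on-line z w m k (r , I) p q =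
      ∈H-pure I m (∈H-resp I (line-difference z w (suc m) k) (~-trans I p (~-sym I q)))

    line-coincidence : ∀ I {z w i j} → i < j → line z w j ~[ I ] line z w i → w ~[ I ] z
    line-coincidence I {z} {w} {i} {j} i<j p = twice-on-line z w (j ℕ.∸ suc i) i (line z w i , I)
      (≡.subst (λ n → line z w n ~[ I ] line z w i) (≡.trans (≡.sym (ℕ.m∸n+n≡m i<j)) (ℕ.+-suc _ i)) p)
      (≈⇒~ I ≈-refl)

    line-injective : ∀ I {z w} → ¬ (w ~[ I ] z) → ∀ i j → line z w i ~[ I ] line z w j → i ≡ j
    line-injective I {z} {w} w≁z i j p with ℕ.<-cmp i j
    ... | tri≈ _ i≡j _ = i≡j
    ... | tri< i<j _ _ = contradiction (line-coincidence I i<j (~-sym I p)) w≁z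
    ... | tri> _ _ j<i = contradiction (line-coincidence I j<i p) w≁z

    -- Points with natural parameters are all that `avoidCosets` moves through. The notion covers
    -- cosets and the whole model alike.
    Affine : Pred Carrier 0ℓ → Set
    Affine B = ∀ {z w} → B z → B w → ∀ k → B (line z w k)

    Eventually : Pred ℕ 0ℓ → Set
    Eventually P = ∃[ k₀ ] (∀ k → k₀ ≤ k → P k)

    -- There is at most one hit: a second one would give `w ~[ I ] z`, so the line would stay in one
    -- coset, and `z` would lie in `c`.
    line-leaves-coset : ∀ z w c → ¬ (z ∈ᶜ c) → Eventually (λ k → ¬ (line z w k ∈ᶜ c))
    line-leaves-coset z w c@(r , I) z∉c with em 0ℓ {∃[ k ] line z w k ∈ᶜ c}
    ... | no never    = 0 , λ k _ p → never (k , p)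
    ... | yes (k , p) = suc k , leaves
      where
      w≁z : ¬ (w ~[ I ] z)
      w≁z q = z∉c (~-trans I
        (~-sym I (∈H-resp I (sym (xyx⁻¹≈y z _)) (×-∈H I k q))) p)
      leaves : ∀ k′ → suc k ≤ k′ → ¬ (line z w k′ ∈ᶜ c)
      leaves k′ k<k′ p′ = w≁z (line-coincidence I k<k′ (~-trans I p′ (~-sym I p)))

    line-leaves-cosets : ∀ z w cs → (∀ {c} → c ∈ˡ cs → ¬ (z ∈ᶜ c)) →
                         Eventually (λ k → ∀ {c} → c ∈ˡ cs → ¬ (line z w k ∈ᶜ c))
    line-leaves-cosets z w []       _    = 0 , λ _ _ ()
    line-leaves-cosets z w (c ∷ cs) z∉cs
      with k₁ , p₁ ← line-leaves-coset z w c (z∉cs (here refl))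
         | k₂ , p₂ ← line-leaves-cosets z w cs (z∉cs ∘ there)
      = k₁ ℕ.⊔ k₂ , λ k le →
        λ { (here refl) → p₁ k (ℕ.≤-trans (ℕ.m≤m⊔n k₁ k₂) le)
          ; (there c∈)  → p₂ k (ℕ.≤-trans (ℕ.m≤n⊔m k₁ k₂) le) c∈
          }

    -- This is the argument that a vector space over an infinite field is no finite union of proper
    -- subspaces: from a point avoiding `cs`, a line towards a point of `B` outside `c` leaves `c`
    -- at once and every coset of `cs` eventually.
    avoidCosets : ∀ {B} → Affine B → ∃ B → ∀ cs →
                  (∀ {c} → c ∈ˡ cs → ∃[ w ] (B w × ¬ (w ∈ᶜ c))) →
                  ∃[ z ] (B z × (∀ {c} → c ∈ˡ cs → ¬ (z ∈ᶜ c)))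
    avoidCosets aff (z , z∈B) []       _     = z , z∈B , λ ()
    avoidCosets {B} aff ∃B    (c@(r , I) ∷ cs) avoid
      with z , z∈B , z∉cs ← avoidCosets aff ∃B cs (avoid ∘ there)
      with em 0ℓ {z ∈ᶜ c}
    ... | no z∉c = z , z∈B , λ { (here refl) → z∉c ; (there c∈) → z∉cs c∈ }
    ... | yes z∈c
      with w , w∈B , w∉c ← avoid (here refl)
      with k , line∉ ← line-leaves-cosets z w cs z∉cs
      -- The parameter has to be nonzero: at 0 the line is still at `z`, inside `c`.
      = line z w (suc k) , aff z∈B w∈B (suc k) , λ
        { (here refl) p → w∉c (~-trans I
            (twice-on-line z w k 0 c
              (≡.subst (λ n → line z w n ∈ᶜ c) (≡.sym (ℕ.+-identityʳ (suc k))) p)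
              (~-resp I (sym (line-0 z w)) ≈-refl z∈c))
            z∈c)
        ; (there c∈) → line∉ (suc k) (ℕ.n≤1+n k) c∈
        }

    coset-affine : ∀ c → Affine (_∈ᶜ c)
    coset-affine (r , I) {z} {w} p q k = ~-trans I
      (∈H-resp I (sym (xyx⁻¹≈y z _)) (×-∈H I k (~-trans I q (~-sym I p)))) p

  -- Quantifier elimination

  Form : Set → Set
  Form X = List (ℤ × X)

  Atom : Set → Set
  Atom X = Form X × FinSubset

  -- (q , s , I) stands for the atomic formula q x + s ∈ H_I in the variable x.
  LinearAtom : Set → Set
  LinearAtom X = ℤ × Form X × FinSubset

  scale : ∀ {X} → ℤ → Form X → Form X
  scale k = List.map (map₁ (k ℤ.*_))

  infixl 6 _⊖_
  _⊖_ : ∀ {X} → Form X → Form X → Form X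
  f ⊖ g = f List.++ scale ℤ.-1ℤ g

  -- For nonzero `q` and `q′` this is the congruence of the roots -s/q and -s′/q′ modulo H_(I ∪ I′),
  -- cleared of denominators; it holds exactly when the two cosets meet.
  eliminant : ∀ {X} → LinearAtom X → LinearAtom X → Atom X
  eliminant (q , s , I) (q′ , s′ , I′) = scale q s′ ⊖ scale q′ s , I ∪ I′

  -- The first list decides the conditions with zero coefficient. The pairs decide both whether
  -- cosets are compatible and whether an intersection of cosets lies in a further one.
  eliminate : ∀ {X} → List (LinearAtom X) → List (Atom X)
  eliminate F = List.map proj₂ F List.++ List.cartesianProductWith eliminant F F

  formOf : ∀ {n} → Tm n → Form (Fin n)
  formOf (var i)                = (ℤ.1ℤ , i) ∷ []
  formOf (fun 0# [])            = []
  formOf (fun +# (s ∷ t ∷ []))  = formOf s List.++ formOf t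
  formOf (fun -# (t ∷ []))      = scale ℤ.-1ℤ (formOf t)

  -- Collects the terms whose variable is sent to `nothing' into a single one.
  isolate : ∀ {X Y : Set} → (Y → Maybe X) → Form Y → ℤ × Form X
  isolate view []            = ℤ.0ℤ , []
  isolate view ((k , y) ∷ f) with view y | isolate view f
  ... | nothing | q , s = k ℤ.+ q , s
  ... | just x  | q , s = q , (k , x) ∷ s

  linearise : ∀ {X Y : Set} → (Y → Maybe X) → Atom Y → LinearAtom X
  linearise view (f , I) = proj₁ (isolate view f) , proj₂ (isolate view f) , I

  predFin : ∀ {n} → Fin (suc n) → Maybe (Fin n)
  predFin zero    = nothing
  predFin (suc i) = just i

  -- Finitely many atoms whose truth values determine that of the formula, in all
  -- models of the theory: a semantic form of quantifier elimination.
  atoms : ∀ {n} → Fm n → List (Atom (Fin n))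
  atoms (s ≐ t)                = (formOf s ⊖ formOf t , ∅) ∷ []
  atoms (rel (H# I) (t ∷ []))  = (formOf t , I) ∷ []
  atoms (¬' φ)                 = atoms φ
  atoms (φ ∧' ψ)               = atoms φ List.++ atoms ψ
  atoms (ex' φ)                = eliminate (List.map (linearise predFin) (atoms φ))

  module Evaluation (M : Structure 𝓛) (𝓖≡M : 𝓖 ≡ₑ M) where
    open Model M 𝓖≡M public
    open import Relation.Binary.Reasoning.Setoid setoid
    open Algebra.Properties.AbelianGroup abelianGroup using (⁻¹-involutive; xyx⁻¹≈y; x∙y⁻¹≈ε⇒x≈y; x≈y⇒x∙y⁻¹≈ε)
    open Algebra.Properties.CommutativeSemigroup commutativeSemigroup using (x∙yz≈y∙xz)

    lin : ∀ {X} → Form X → (X → Carrier) → Carrier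
    lin []            env = 𝟘
    lin ((k , x) ∷ f) env = k • env x + lin f env

    module _ {X : Set} where

      lin-cong : ∀ (f : Form X) {env env′ : X → Carrier} → (∀ x → env x ≈ env′ x) → lin f env ≈ lin f env′
      lin-cong []            p = ≈-refl
      lin-cong ((k , x) ∷ f) p = +-cong (•-cong k (p x)) (lin-cong f p)

      lin-++ : ∀ (f g : Form X) env → lin (f List.++ g) env ≈ lin f env + lin g env
      lin-++ []            g env = sym (+-identityˡ _)
      lin-++ ((k , x) ∷ f) g env = trans (+-congˡ (lin-++ f g env)) (sym (+-assoc _ _ _))

      lin-scale : ∀ k (f : Form X) env → lin (scale k f) env ≈ k • lin f env
      lin-scale k []            env = sym (•-𝟘 k)
      lin-scale k ((l , x) ∷ f) env =
        trans (+-cong (*-• k l (env x)) (lin-scale k f env)) (sym (•-distribˡ k _ _))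

      lin-⊖ : ∀ (f g : Form X) env → lin (f ⊖ g) env ≈ lin f env - lin g env
      lin-⊖ f g env = trans (lin-++ f (scale ℤ.-1ℤ g) env)
        (+-congˡ (trans (lin-scale ℤ.-1ℤ g env) (-‿cong (1•x≈x _))))

      infix 4 _⊩_ _,_⊩ₗ_
      _⊩_ : (X → Carrier) → Atom X → Set
      env ⊩ (f , I) = lin f env ∈H I

      _,_⊩ₗ_ : Carrier → (X → Carrier) → LinearAtom X → Set
      x , env ⊩ₗ (q , s , I) = q • x + lin s env ∈H I

      ⊩ₗ-0 : ∀ s I x env → (x , env ⊩ₗ (ℤ.0ℤ , s , I)) ⇔ (env ⊩ (s , I))
      ⊩ₗ-0 s I x env = mk⇔ (∈H-resp I (+-identityˡ _)) (∈H-resp I (sym (+-identityˡ _)))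

      root : (X → Carrier) → LinearAtom X → Carrier
      root env (q , s , I) with q ℤ.≟ ℤ.0ℤ
      -- A default value: the properties of roots are stated for nonzero coefficients.
      ... | yes _  = 𝟘
      ... | no q≢0 = proj₁ (quotient q q≢0 (- lin s env))

      root-spec : ∀ env a → proj₁ a ≢ ℤ.0ℤ → proj₁ a • root env a ≈ - lin (proj₁ (proj₂ a)) env
      root-spec env (q , s , I) q≢0 with q ℤ.≟ ℤ.0ℤ
      ... | yes q≡0 = contradiction q≡0 q≢0
      ... | no q≢0′ = proj₂ (quotient q q≢0′ (- lin s env))

      cosetOf : (X → Carrier) → LinearAtom X → Coset
      cosetOf env a@(_ , _ , I) = root env a , I

      ⊩ₗ⇔∈coset : ∀ x env a → proj₁ a ≢ ℤ.0ℤ → (x , env ⊩ₗ a) ⇔ (x ∈ᶜ cosetOf env a)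
      ⊩ₗ⇔∈coset x env a@(q , s , I) q≢0 = mk⇔
        (λ p → ~-•⁻ I q q≢0 (∈H-resp I (sym difference) p))
        (λ p → ∈H-resp I difference (~-•⁺ I q p))
        where
        difference : q • x - q • root env a ≈ q • x + lin s env
        difference = +-congˡ (trans (-‿cong (root-spec env a q≢0)) (⁻¹-involutive _))

      ⊩eliminant⇔~ : ∀ env a b → proj₁ a ≢ ℤ.0ℤ → proj₁ b ≢ ℤ.0ℤ → let I = proj₂ (eliminant a b) in
                     (env ⊩ eliminant a b) ⇔ (root env a ~[ I ] root env b)
      ⊩eliminant⇔~ env a@(q , s , I) b@(q′ , s′ , I′) q≢0 q′≢0 = mk⇔
        (λ p → ~-•⁻ J q q≢0 (~-•⁻ J q′ q′≢0 (∈H-resp J (sym difference) p)))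
        (λ p → ∈H-resp J difference (~-•⁺ J q′ (~-•⁺ J q p)))
        where
        J = I ∪ I′
        r = root env a
        r′ = root env b
        difference : q′ • q • r - q′ • q • r′ ≈ lin (scale q s′ ⊖ scale q′ s) env
        difference = begin
          q′ • q • r - q′ • q • r′                       ≈⟨ +-cong (•-cong q′ (root-spec env a q≢0)) (-‿cong (•-comm q′ q r′)) ⟩
          q′ • (- lin s env) - q • q′ • r′               ≈⟨ +-cong (•-neg q′ _)
                                                              (-‿cong (trans (•-cong q (root-spec env b q′≢0)) (•-neg q _))) ⟩
          - (q′ • lin s env) - - (q • lin s′ env)        ≈⟨ +-comm _ _ ⟩
          - - (q • lin s′ env) - q′ • lin s env          ≈⟨ +-congʳ (⁻¹-involutive _) ⟩
          q • lin s′ env - q′ • lin s env                ≈⟨ +-cong (lin-scale q s′ env) (-‿cong (lin-scale q′ s env)) ⟨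
          lin (scale q s′) env - lin (scale q′ s) env    ≈⟨ lin-⊖ (scale q s′) (scale q′ s) env ⟨
          lin (scale q s′ ⊖ scale q′ s) env              ∎

    lin-rename : ∀ {X Y : Set} (ρ : X → Y) (f : Form X) (env : Y → Carrier) →
                 lin (List.map (map₂ ρ) f) env ≡ lin f (env ∘ ρ)
    lin-rename ρ []            env = refl
    lin-rename ρ ((k , x) ∷ f) env = ≡.cong (k • env (ρ x) +_) (lin-rename ρ f env)

    lin-formOf : ∀ {n} v (t : Tm n) → eval M v t ≈ lin (formOf t) (lookup v)
    lin-formOf v (var i)               = sym (trans (+-identityʳ _) (1•x≈x _))
    lin-formOf v (fun 0# [])           = ≈-refl
    lin-formOf v (fun +# (s ∷ t ∷ [])) =
      trans (+-cong (lin-formOf v s) (lin-formOf v t)) (sym (lin-++ (formOf s) (formOf t) (lookup v)))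
    lin-formOf v (fun -# (t ∷ []))     =
      trans (-‿cong (lin-formOf v t)) (sym (trans (lin-scale ℤ.-1ℤ (formOf t) (lookup v)) (-‿cong (1•x≈x _))))

    ≈⇔⊩ : ∀ {n} (s t : Tm n) v → (eval M v s ≈ eval M v t) ⇔ (lookup v ⊩ (formOf s ⊖ formOf t , ∅))
    ≈⇔⊩ s t v = mk⇔
      (λ p → ∈H-resp ∅ (trans (sym (x≈y⇒x∙y⁻¹≈ε p)) difference) (0∈H ∅))
      (λ p → x∙y⁻¹≈ε⇒x≈y _ _ (trans difference (∈H-∅ p)))
      where
      difference : eval M v s - eval M v t ≈ lin (formOf s ⊖ formOf t) (lookup v)
      difference = trans (+-cong (lin-formOf v s) (-‿cong (lin-formOf v t)))
        (sym (lin-⊖ (formOf s) (formOf t) (lookup v)))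

    module _ {X Y : Set} (view : Y → Maybe X) (x : Carrier) (env : X → Carrier) (env⁺ : Y → Carrier)
             (env⁺≡ : ∀ y → env⁺ y ≡ maybe′ env x (view y)) where

      lin-isolate : ∀ f → let (q , s) = isolate view f in q • x + lin s env ≈ lin f env⁺
      lin-isolate []            = +-identityˡ _
      lin-isolate ((k , y) ∷ f) with view y | isolate view f | lin-isolate f | env⁺≡ y
      ... | nothing | q , s | ih | y≡ = begin
        (k ℤ.+ q) • x + lin s env      ≈⟨ +-congʳ (•-distribʳ k q x) ⟩
        (k • x + q • x) + lin s env    ≈⟨ +-assoc _ _ _ ⟩
        k • x + (q • x + lin s env)    ≈⟨ +-cong (reflexive (≡.cong (k •_) (≡.sym y≡))) ih ⟩
        k • env⁺ y + lin f env⁺        ∎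
      ... | just x′ | q , s | ih | y≡ = begin
        q • x + (k • env x′ + lin s env)    ≈⟨ x∙yz≈y∙xz _ _ _ ⟩
        k • env x′ + (q • x + lin s env)    ≈⟨ +-cong (reflexive (≡.cong (k •_) (≡.sym y≡))) ih ⟩
        k • env⁺ y + lin f env⁺             ∎

      ⊩-linearise : ∀ a → (x , env ⊩ₗ linearise view a) ⇔ (env⁺ ⊩ a)
      ⊩-linearise (f , I) = mk⇔ (∈H-resp I (lin-isolate f)) (∈H-resp I (sym (lin-isolate f)))

    lookup-predFin : ∀ {n} x (v : Vec Carrier n) i → lookup (x ∷ v) i ≡ maybe′ (lookup v) x (predFin i)
    lookup-predFin x v zero    = refl
    lookup-predFin x v (suc i) = refl

    coset⊈coset : ∀ r I s J → I ⊈ J → ∃[ w ] (w ∈ᶜ (r , I) × ¬ (w ∈ᶜ (s , J)))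
    coset⊈coset r I s J I⊈J with em 0ℓ {r ∈ᶜ (s , J)}
    ... | no r∉ = r , ≈⇒~ I ≈-refl , r∉
    ... | yes r∈ with h , h∈I , h∉J ← ∈H-proper I J I⊈J
      = r + h , ∈H-resp I (sym (xyx⁻¹≈y r h)) h∈I ,
        λ r+h∈ → h∉J (∈H-resp J (xyx⁻¹≈y r h) (~-trans J r+h∈ (~-sym J r∈)))

    coset≢everything : ∀ c → ∃[ w ] ¬ (w ∈ᶜ c)
    -- The bound `b` of `J` is an index outside `J`, so H of `initial (suc b)` is not contained in
    -- H_J.
    coset≢everything (s , J) = map₂ proj₂ (coset⊈coset 𝟘 (initial (suc b)) s J
      (b , List.∈-upTo⁺ ℕ.≤-refl , λ b∈J → ℕ.<-irrefl refl (<-strictBound J b∈J)))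
      where b = strictBound J

    -- When the cosets in `pos' have a common element, Covered d pos says that
    -- their intersection is contained in d; it only mentions congruences between
    -- the representatives.
    Covered : Coset → List Coset → Set
    -- The empty intersection is the whole model, which no coset contains.
    Covered d       []           = ⊥
    Covered (s , J) (c ∷ cs) =
      ⋂ (proj₂ c) (List.map proj₂ cs) ⊆ J × (∀ {e} → e ∈ˡ (c ∷ cs) → s ~[ J ∪ proj₂ e ] proj₁ e)

    covered-∈ : ∀ d pos → Covered d pos → ∀ {z} → (∀ {e} → e ∈ˡ pos → z ∈ᶜ e) → z ∈ᶜ d
    covered-∈ (s , J) pos@(c ∷ cs) (⋂⊆J , s~) {z} z∈ = ∈H-⊆ (J ∪ ⋂ I Is) J
      ([ id , ⋂⊆J ]′ ∘ ∈-∪⁻ J (⋂ I Is))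
      (∈H-⋂ J I Is λ {I′} I′∈ → let (e , e∈ , I′≡) = List.∈-map⁻ proj₂ {xs = pos} I′∈ in
        ≡.subst (λ I′ → z ~[ J ∪ I′ ] s) (≡.sym I′≡)
          (~-trans (J ∪ proj₂ e) (~-∪ʳ J (proj₂ e) (z∈ e∈)) (~-sym (J ∪ proj₂ e) (s~ e∈))))
      where
      I = proj₂ c
      Is = List.map proj₂ cs

    -- The cosets in a nonempty `pos` meet in a coset `(z , K)`. A negative coset with `K ⊆ J` that
    -- contained `z` would be covered, so each negative coset misses some point of `(z , K)` and
    -- avoidance applies.
    separate : ∀ pos neg → Compatible pos → (∀ {d} → d ∈ˡ neg → ¬ Covered d pos) →
               ∃[ y ] ((∀ {c} → c ∈ˡ pos → y ∈ᶜ c) × (∀ {d} → d ∈ˡ neg → ¬ (y ∈ᶜ d)))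
    separate [] neg _ _ with y , _ , y∉ ← avoidCosets {λ _ → 𝟘 ≈ 𝟘} (λ _ _ _ → ≈-refl) (𝟘 , ≈-refl) neg
                                     (λ {d} _ → map₂ (≈-refl ,_) (coset≢everything d))
      = y , (λ ()) , y∉
    separate (c ∷ cs) neg compat uncovered = y , inside , y∉
      where
      K = ⋂ (proj₂ c) (List.map proj₂ cs)
      solution : ∃[ z ] (∀ {e} → e ∈ˡ (c ∷ cs) → z ∈ᶜ e)
      solution = chineseRemainder c cs compat
      z = proj₁ solution
      z∈ : ∀ {e} → e ∈ˡ (c ∷ cs) → z ∈ᶜ e
      z∈ = proj₂ solution
      avoidable : ∀ {d} → d ∈ˡ neg → ∃[ w ] (w ∈ᶜ (z , K) × ¬ (w ∈ᶜ d))
      avoidable {s , J} d∈ with ⊆-or-⊈ K J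
      ... | inj₂ K⊈J = coset⊈coset z K s J K⊈J
      ... | inj₁ K⊆J = z , ≈⇒~ K ≈-refl , λ z~s → uncovered d∈
        (K⊆J , λ {e} e∈ → ~-trans (J ∪ proj₂ e) (~-∪ˡ J (proj₂ e) (~-sym J z~s)) (~-∪ʳ J (proj₂ e) (z∈ e∈)))
      found : ∃[ y ] (y ∈ᶜ (z , K) × (∀ {d} → d ∈ˡ neg → ¬ (y ∈ᶜ d)))
      found = avoidCosets (coset-affine (z , K)) (z , ≈⇒~ K ≈-refl) neg avoidable
      y = proj₁ found
      y∉ : ∀ {d} → d ∈ˡ neg → ¬ (y ∈ᶜ d)
      y∉ = proj₂ (proj₂ found)
      inside : ∀ {e} → e ∈ˡ (c ∷ cs) → y ∈ᶜ e
      inside {e} e∈ = ~-trans (proj₂ e)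
        (∈H-⊆ K (proj₂ e) (⋂-⊆ (proj₂ c) (List.map proj₂ cs) (List.∈-map⁺ proj₂ e∈)) (proj₁ (proj₂ found)))
        (z∈ e∈)

  -- Back and forth between two models

  module BackAndForth (M : Structure 𝓛) (𝓖≡M : 𝓖 ≡ₑ M) (N : Structure 𝓛) (𝓖≡N : 𝓖 ≡ₑ N) where
    private
      module M = Evaluation M 𝓖≡M
      module N = Evaluation N 𝓖≡N

    Agree : ∀ {X} → List (Atom X) → (X → ∣ M ∣) → (X → ∣ N ∣) → Set
    Agree F env env′ = ∀ {a} → a ∈ˡ F → (env M.⊩ a) ⇔ (env′ N.⊩ a)

    -- `y` must lie in the counterparts of the cosets that contain `x` and avoid those of the
    -- others. By `N.separate` this is possible subject to congruences between roots, which are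
    -- eliminants and hence shared by `M` and `N`.
    forth : ∀ {X} (F : List (LinearAtom X)) (env : X → ∣ M ∣) (env′ : X → ∣ N ∣) →
            Agree (eliminate F) env env′ →
            ∀ x → ∃[ y ] (∀ {a} → a ∈ˡ F → (x M., env ⊩ₗ a) ⇔ (y N., env′ ⊩ₗ a))
    forth {X} F env env′ agree x = y , λ {a} → matches a
      where
      Pos Neg : Pred (LinearAtom X) 0ℓ
      Pos a = proj₁ a ≢ ℤ.0ℤ × (x M., env ⊩ₗ a)
      Neg a = proj₁ a ≢ ℤ.0ℤ × ¬ (x M., env ⊩ₗ a)
      Pos? : ∀ a → Dec (Pos a)
      Pos? a = em 0ℓ
      Neg? : ∀ a → Dec (Neg a)
      Neg? a = em 0ℓ
      pos neg : List (LinearAtom X)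
      pos = List.filter Pos? F
      neg = List.filter Neg? F

      rootsM rootsN : List (LinearAtom X) → List _
      rootsM = List.map (M.cosetOf env)
      rootsN = List.map (N.cosetOf env′)

      ∈-pos : ∀ {a} → a ∈ˡ pos → a ∈ˡ F × Pos a
      ∈-pos = List.∈-filter⁻ Pos? {xs = F}

      ∈-neg : ∀ {a} → a ∈ˡ neg → a ∈ˡ F × Neg a
      ∈-neg = List.∈-filter⁻ Neg? {xs = F}

      agree-eliminant : ∀ {a b} → a ∈ˡ F → b ∈ˡ F → proj₁ a ≢ ℤ.0ℤ → proj₁ b ≢ ℤ.0ℤ →
        let I = proj₂ (eliminant a b) in
        (M.root env a M.~[ I ] M.root env b) ⇔ (N.root env′ a N.~[ I ] N.root env′ b)
      agree-eliminant {a} {b} a∈ b∈ a≢0 b≢0 = mk⇔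
        (to (N.⊩eliminant⇔~ env′ a b a≢0 b≢0) ∘ to agree-ab ∘ from (M.⊩eliminant⇔~ env a b a≢0 b≢0))
        (to (M.⊩eliminant⇔~ env a b a≢0 b≢0) ∘ from agree-ab ∘ from (N.⊩eliminant⇔~ env′ a b a≢0 b≢0))
        where
        agree-ab = agree (List.∈-++⁺ʳ (List.map proj₂ F) (List.∈-cartesianProductWith⁺ eliminant a∈ b∈))

      x∈pos : ∀ {c} → c ∈ˡ rootsM pos → x M.∈ᶜ c
      x∈pos c∈ with a , a∈ , refl ← List.∈-map⁻ (M.cosetOf env) c∈
               with a∈F , a≢0 , holds ← ∈-pos a∈ = to (M.⊩ₗ⇔∈coset x env a a≢0) holds

      compatible : N.Compatible (rootsN pos)
      compatible c∈ d∈ with a , a∈ , refl ← List.∈-map⁻ (N.cosetOf env′) c∈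
                          | b , b∈ , refl ← List.∈-map⁻ (N.cosetOf env′) d∈
                       with a∈F , a≢0 , p ← ∈-pos a∈ | b∈F , b≢0 , q ← ∈-pos b∈
        = to (agree-eliminant a∈F b∈F a≢0 b≢0)
            (M.~-trans I∪J (M.~-sym I∪J (M.~-∪ˡ I J (to (M.⊩ₗ⇔∈coset x env a a≢0) p)))
              (M.~-∪ʳ I J (to (M.⊩ₗ⇔∈coset x env b b≢0) q)))
        where
        I = proj₂ (proj₂ a)
        J = proj₂ (proj₂ b)
        I∪J = I ∪ J

      covered : ∀ {b} as → b ∈ˡ F → proj₁ b ≢ ℤ.0ℤ → (∀ {a} → a ∈ˡ as → a ∈ˡ F × Pos a) →
                N.Covered (N.cosetOf env′ b) (rootsN as) → M.Covered (M.cosetOf env b) (rootsM as)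
      covered {b} (a ∷ as) b∈F b≢0 as⊆ (⋂⊆J , s~) = ⋂⊆J′ , λ e∈ → s~′ e∈
        where
        sameSets : ∀ as → List.map proj₂ (rootsN as) ≡ List.map proj₂ (rootsM as)
        sameSets as = ≡.trans (≡.sym (List.map-∘ as)) (List.map-∘ as)
        ⋂⊆J′ : ⋂ (proj₂ (proj₂ a)) (List.map proj₂ (rootsM as)) ⊆ proj₂ (proj₂ b)
        ⋂⊆J′ = ≡.subst (λ Is → ⋂ (proj₂ (proj₂ a)) Is ⊆ proj₂ (proj₂ b)) (sameSets as) ⋂⊆J
        s~′ : ∀ {e} → e ∈ˡ rootsM (a ∷ as) → M.root env b M.~[ proj₂ (proj₂ b) ∪ proj₂ e ] proj₁ e
        s~′ e∈ with d , d∈ , refl ← List.∈-map⁻ (M.cosetOf env) {xs = a ∷ as} e∈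
          = from (agree-eliminant b∈F (proj₁ (as⊆ d∈)) b≢0 (proj₁ (proj₂ (as⊆ d∈))))
              (s~ (List.∈-map⁺ (N.cosetOf env′) d∈))

      -- Coveredness in `N` would pull back to `M` and force `x` into a coset that it avoids.
      uncovered : ∀ {d} → d ∈ˡ rootsN neg → ¬ N.Covered d (rootsN pos)
      uncovered d∈ cov with b , b∈ , refl ← List.∈-map⁻ (N.cosetOf env′) d∈
                       with b∈F , b≢0 , fails ← ∈-neg b∈
        = fails (from (M.⊩ₗ⇔∈coset x env b b≢0)
            (M.covered-∈ (M.cosetOf env b) (rootsM pos) (covered pos b∈F b≢0 ∈-pos cov) x∈pos))

      solution : ∃[ y ] ((∀ {c} → c ∈ˡ rootsN pos → y N.∈ᶜ c) × (∀ {d} → d ∈ˡ rootsN neg → ¬ (y N.∈ᶜ d)))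
      solution = N.separate (rootsN pos) (rootsN neg) compatible uncovered
      y = proj₁ solution

      matches : ∀ a → a ∈ˡ F → (x M., env ⊩ₗ a) ⇔ (y N., env′ ⊩ₗ a)
      matches a@(q , s , I) a∈ with q ℤ.≟ ℤ.0ℤ
      ... | yes refl = mk⇔
        (from (N.⊩ₗ-0 s I y env′) ∘ to agree-a ∘ to (M.⊩ₗ-0 s I x env))
        (from (M.⊩ₗ-0 s I x env) ∘ from agree-a ∘ to (N.⊩ₗ-0 s I y env′))
        where agree-a = agree (List.∈-++⁺ˡ (List.∈-map⁺ proj₂ a∈))
      ... | no q≢0 = mk⇔
        (λ p → from (N.⊩ₗ⇔∈coset y env′ a q≢0)
          (proj₁ (proj₂ solution) (List.∈-map⁺ (N.cosetOf env′) (List.∈-filter⁺ Pos? a∈ (q≢0 , p)))))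
        (λ p → dne λ ¬p → proj₂ (proj₂ solution)
          (List.∈-map⁺ (N.cosetOf env′) (List.∈-filter⁺ Neg? a∈ (q≢0 , ¬p))) (to (N.⊩ₗ⇔∈coset y env′ a q≢0) p))

    agree-linearise : ∀ {X Y : Set} (view : Y → Maybe X) F {env env⁺ env′ env′⁺} x y →
      (∀ z → env⁺ z ≡ maybe′ env x (view z)) → (∀ z → env′⁺ z ≡ maybe′ env′ y (view z)) →
      (∀ {a} → a ∈ˡ List.map (linearise view) F → (x M., env ⊩ₗ a) ⇔ (y N., env′ ⊩ₗ a)) →
      Agree F env⁺ env′⁺
    agree-linearise view F {env} {env⁺} {env′} {env′⁺} x y env≡ env′≡ agree {a} a∈ = mk⇔
      (to (N.⊩-linearise view y env′ env′⁺ env′≡ a) ∘ to agree-a ∘ from (M.⊩-linearise view x env env⁺ env≡ a))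
      (to (M.⊩-linearise view x env env⁺ env≡ a) ∘ from agree-a ∘ from (N.⊩-linearise view y env′ env′⁺ env′≡ a))
      where agree-a = agree (List.∈-map⁺ (linearise view) a∈)

    ≐-preserved : ∀ {n} (s t : Tm n) v w → Agree (atoms (s ≐ t)) (lookup v) (lookup w) →
                  M ⊨ s ≐ t [ v ] → N ⊨ s ≐ t [ w ]
    ≐-preserved s t v w agree = from (N.≈⇔⊩ s t w) ∘ to (agree (here refl)) ∘ to (M.≈⇔⊩ s t v)

    H′-preserved : ∀ {n} I (t : Tm n) v w → Agree (atoms (H′ I t)) (lookup v) (lookup w) →
                   M ⊨ H′ I t [ v ] → N ⊨ H′ I t [ w ]
    H′-preserved I t v w agree p =
      N.∈H-resp I (N.sym (N.lin-formOf w t)) (to (agree (here refl)) (M.∈H-resp I (M.lin-formOf v t) p))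

  -- The models are arguments rather than module parameters because the case of negation exchanges
  -- them in the recursive call.
  preserved : ∀ M 𝓖≡M N 𝓖≡N {n} (φ : Fm n) v w → BackAndForth.Agree M 𝓖≡M N 𝓖≡N (atoms φ) (lookup v) (lookup w) →
              M ⊨ φ [ v ] → N ⊨ φ [ w ]
  preserved M 𝓖≡M N 𝓖≡N (s ≐ t)               v w agree p = BackAndForth.≐-preserved M 𝓖≡M N 𝓖≡N s t v w agree p
  preserved M 𝓖≡M N 𝓖≡N (rel (H# I) (t ∷ [])) v w agree p = BackAndForth.H′-preserved M 𝓖≡M N 𝓖≡N I t v w agree p
  preserved M 𝓖≡M N 𝓖≡N (¬' φ)   v w agree ¬p q =
    ¬p (preserved N 𝓖≡N M 𝓖≡M φ w v (λ a∈ → mk⇔ (from (agree a∈)) (to (agree a∈))) q)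
  preserved M 𝓖≡M N 𝓖≡N (φ ∧' ψ) v w agree (p , q) =
    preserved M 𝓖≡M N 𝓖≡N φ v w (agree ∘ List.∈-++⁺ˡ) p , preserved M 𝓖≡M N 𝓖≡N ψ v w (agree ∘ List.∈-++⁺ʳ (atoms φ)) q
  preserved M 𝓖≡M N 𝓖≡N (ex' φ)  v w agree (x , p)
    with y , matches ← BackAndForth.forth M 𝓖≡M N 𝓖≡N (List.map (linearise predFin) (atoms φ)) (lookup v) (lookup w) agree x
    = y , preserved M 𝓖≡M N 𝓖≡N φ (x ∷ v) (y ∷ w)
        (BackAndForth.agree-linearise M 𝓖≡M N 𝓖≡N predFin (atoms φ) x y
          (Evaluation.lookup-predFin M 𝓖≡M x v) (Evaluation.lookup-predFin N 𝓖≡N y w) matches) p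

  -- Morley rank

  infixr 10 _•′_
  _•′_ : ∀ {n} → ℤ → Tm n → Tm n
  (ℤ.+ k)  •′ t = k ×′ t
  -[1+ k ] •′ t = -′ (suc k ×′ t)

  -- Every monomial gets its own variable, even if a name recurs, so names need not have decidable
  -- equality.
  toTerm : ∀ {A : Set} {n} (f : Form A) → (Fin (List.length f) → Fin n) → Tm n
  toTerm []            ρ = 0′
  toTerm ((k , _) ∷ f) ρ = (k •′ var (ρ zero)) +′ toTerm f (ρ ∘ suc)

  parameters : ∀ {A : Set} (f : Form A) → Vec A (List.length f)
  parameters f = Vec.tabulate (proj₂ ∘ List.lookup f)

  lookup-parameters : ∀ {A B : Set} (f : Form A) (a : A → B) i →
                      lookup (Vec.map a (parameters f)) i ≡ a (proj₂ (List.lookup f i))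
  lookup-parameters f a i =
    ≡.trans (Vec.lookup-map i a (parameters f)) (≡.cong a (Vec.lookup∘tabulate (proj₂ ∘ List.lookup f) i))

  module ToTerm (M : Structure 𝓛) (𝓖≡M : 𝓖 ≡ₑ M) where
    open Evaluation M 𝓖≡M

    eval-•′ : ∀ {n} k (t : Tm n) v → eval M v (k •′ t) ≡ k • eval M v t
    eval-•′ (ℤ.+ k)  t v = eval-×′ k t v
    eval-•′ -[1+ k ] t v = ≡.cong -_ (eval-×′ (suc k) t v)

    eval-toTerm : ∀ {A : Set} {n} (f : Form A) (ρ : Fin (List.length f) → Fin n) v (a : A → Carrier) →
                  (∀ i → lookup v (ρ i) ≡ a (proj₂ (List.lookup f i))) → eval M v (toTerm f ρ) ≡ lin f a
    eval-toTerm []            ρ v a p = refl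
    eval-toTerm ((k , x) ∷ f) ρ v a p = ≡.cong₂ _+_
      (≡.trans (eval-•′ k (var (ρ zero)) v) (≡.cong (k •_) (p zero)))
      (eval-toTerm f (ρ ∘ suc) v a (p ∘ suc))

    ⊨toTerm : ∀ {A : Set} (f : Form A) I (a : A → Carrier) →
              (M ⊨ H′ I (toTerm f id) [ Vec.map a (parameters f) ]) ⇔ (a ⊩ (f , I))
    ⊨toTerm f I a = mk⇔ (≡.subst (_∈H I) lhs≡rhs) (≡.subst (_∈H I) (≡.sym lhs≡rhs))
      where lhs≡rhs = eval-toTerm f id (Vec.map a (parameters f)) a (lookup-parameters f a)

  sameTheory⇒agree : ∀ {A : Set} M 𝓖≡M (a : A → ∣ M ∣) N 𝓖≡N (c : A → ∣ N ∣) → SameTheory M a N c →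
                     ∀ F → BackAndForth.Agree M 𝓖≡M N 𝓖≡N F a c
  sameTheory⇒agree M 𝓖≡M a N 𝓖≡N c same F {f , I} _ = mk⇔
    (to (ToTerm.⊨toTerm N 𝓖≡N f I c) ∘ to same-f ∘ from (ToTerm.⊨toTerm M 𝓖≡M f I a))
    (to (ToTerm.⊨toTerm M 𝓖≡M f I a) ∘ from same-f ∘ from (ToTerm.⊨toTerm N 𝓖≡N f I c))
    where same-f = same (H′ I (toTerm f id)) (parameters f)

  sameTheory⇒≡ₑ : ∀ {A : Set} {M} {a : A → ∣ M ∣} {N} {c : A → ∣ N ∣} → 𝓖 ≡ₑ M → SameTheory M a N c → 𝓖 ≡ₑ N
  sameTheory⇒≡ₑ 𝓖≡M same φ = mk⇔ (to (same φ []) ∘ to (𝓖≡M φ)) (from (𝓖≡M φ) ∘ from (same φ []))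

  -- Small and cosmall definable sets

  module Dichotomy (M : Structure 𝓛) (𝓖≡M : 𝓖 ≡ₑ M) where
    open Evaluation M 𝓖≡M public

    infix 4 _∈⋃_
    _∈⋃_ : Carrier → List Coset → Set
    x ∈⋃ cs = ∃[ c ] (c ∈ˡ cs × x ∈ᶜ c)

    ∈⋃-++⁺ˡ : ∀ {x cs ds} → x ∈⋃ cs → x ∈⋃ cs List.++ ds
    ∈⋃-++⁺ˡ (c , c∈ , x∈) = c , List.∈-++⁺ˡ c∈ , x∈

    ∈⋃-++⁺ʳ : ∀ {x} cs {ds} → x ∈⋃ ds → x ∈⋃ cs List.++ ds
    ∈⋃-++⁺ʳ cs (c , c∈ , x∈) = c , List.∈-++⁺ʳ cs c∈ , x∈

    Sat : PFormula 𝓛 Carrier 1 → Pred Carrier 0ℓ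
    Sat φ x = Holds M id φ (x ∷ [])

    NoneContains : Pred Carrier 0ℓ → List Coset → Set
    NoneContains B cs = ∀ {c} → c ∈ˡ cs → ∃[ w ] (B w × ¬ (w ∈ᶜ c))

    -- By `avoidCosets` finitely many cosets not containing `B` never exhaust a nonempty affine `B`;
    -- the cosmall formulas thus form the generic type of `B`.
    SmallIn CosmallIn : Pred Carrier 0ℓ → PFormula 𝓛 Carrier 1 → Set
    SmallIn   B φ = ∃[ cs ] (NoneContains B cs × (∀ {x} → B x → Sat φ x → x ∈⋃ cs))
    CosmallIn B φ = ∃[ cs ] (NoneContains B cs × (∀ {x} → B x → ¬ Sat φ x → x ∈⋃ cs))

    -- Discard the atoms' cosets that do not contain `B`: the remaining points of `B` satisfy the
    -- same atoms, so `φ` has a constant truth value on them.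
    small-or-cosmall : ∀ B φ → SmallIn B φ ⊎ CosmallIn B φ
    small-or-cosmall B (m , ϕ , b) = conclude (em 0ℓ {∃[ x ] (B x × ¬ (x ∈⋃ cs) × Sat φ x)})
      where
      φ : PFormula 𝓛 Carrier 1
      φ = m , ϕ , b
      env : Fin m → Carrier
      env = lookup (Vec.map id b)
      F : List (LinearAtom (Fin m))
      F = List.map (linearise predFin) (atoms ϕ)
      Proper : Pred (LinearAtom (Fin m)) 0ℓ
      Proper a = proj₁ a ≢ ℤ.0ℤ × ∃[ w ] (B w × ¬ (w ∈ᶜ cosetOf env a))
      Proper? : ∀ a → Dec (Proper a)
      Proper? a = em 0ℓ
      cs : List Coset
      cs = List.map (cosetOf env) (List.filter Proper? F)

      noneContains : NoneContains B cs
      noneContains c∈ with a , a∈ , refl ← List.∈-map⁻ (cosetOf env) c∈ = proj₂ (proj₂ (List.∈-filter⁻ Proper? {xs = F} a∈))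

      sameAtom : ∀ {x y} → B x → ¬ (x ∈⋃ cs) → B y → ¬ (y ∈⋃ cs) →
                 ∀ {a} → a ∈ˡ F → (x , env ⊩ₗ a) → (y , env ⊩ₗ a)
      sameAtom {x} {y} x∈B x∉ y∈B y∉ {a@(q , s , I)} a∈ p with q ℤ.≟ ℤ.0ℤ
      ... | yes refl = from (⊩ₗ-0 s I y env) (to (⊩ₗ-0 s I x env) p)
      ... | no q≢0   = from (⊩ₗ⇔∈coset y env a q≢0) (dne λ y∉a → x∉
        (cosetOf env a , List.∈-map⁺ (cosetOf env) (List.∈-filter⁺ Proper? a∈ (q≢0 , y , y∈B , y∉a))
        , to (⊩ₗ⇔∈coset x env a q≢0) p))

      sameTruth : ∀ {x y} → B x → ¬ (x ∈⋃ cs) → B y → ¬ (y ∈⋃ cs) → Sat φ x → Sat φ y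
      sameTruth {x} {y} x∈B x∉ y∈B y∉ = preserved M 𝓖≡M M 𝓖≡M ϕ (x ∷ Vec.map id b) (y ∷ Vec.map id b)
        (BackAndForth.agree-linearise M 𝓖≡M M 𝓖≡M predFin (atoms ϕ) x y
          (lookup-predFin x (Vec.map id b)) (lookup-predFin y (Vec.map id b))
          λ a∈ → mk⇔ (sameAtom x∈B x∉ y∈B y∉ a∈) (sameAtom y∈B y∉ x∈B x∉ a∈))

      conclude : Dec (∃[ x ] (B x × ¬ (x ∈⋃ cs) × Sat φ x)) → SmallIn B φ ⊎ CosmallIn B φ
      conclude (yes (x , x∈B , x∉ , p)) = inj₂ (cs , noneContains ,
        λ y∈B ¬q → dne λ y∉ → ¬q (sameTruth x∈B x∉ y∈B y∉ p))
      conclude (no never) = inj₁ (cs , noneContains , λ {x} x∈B p → dne λ x∉ → never (x , x∈B , x∉ , p))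

    cosmall-meet : ∀ {B} φ ψ → Affine B → ∃ B → CosmallIn B φ → CosmallIn B ψ → ∃[ x ] (Sat φ x × Sat ψ x)
    cosmall-meet φ ψ affine ∃B (cs , cs⊉ , covers) (ds , ds⊉ , covers′)
      with x , x∈B , x∉ ← avoidCosets affine ∃B (cs List.++ ds) ([ cs⊉ , ds⊉ ]′ ∘ List.∈-++⁻ cs)
      = x , dne (λ ¬p → let (c , c∈ , x∈) = covers x∈B ¬p in x∉ (List.∈-++⁺ˡ c∈) x∈)
          , dne (λ ¬p → let (c , c∈ , x∈) = covers′ x∈B ¬p in x∉ (List.∈-++⁺ʳ cs c∈) x∈)

    SizesBelow : ℕ → List Coset → Set
    SizesBelow n cs = ∀ {c} → c ∈ˡ cs → ∣ proj₂ c ∣ᶠ < n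

    sizesBelow : ∀ cs → ∃[ n ] SizesBelow n cs
    sizesBelow []             = 0 , λ ()
    sizesBelow ((_ , I) ∷ cs) with n , below ← sizesBelow cs = suc ∣ I ∣ᶠ ℕ.⊔ n ,
      λ { (here refl) → ℕ.m≤m⊔n (suc ∣ I ∣ᶠ) n
        ; (there c∈)  → ℕ.≤-trans (below c∈) (ℕ.m≤n⊔m (suc ∣ I ∣ᶠ) n) }

    -- A coset meeting `c` in `z` cuts out of it the coset of `z` modulo `I ∩ J`. This is strictly
    -- smaller, for `I ⊆ J` would put all of `c` inside.
    shrink : ∀ c cs → NoneContains (_∈ᶜ c) cs →
             ∃[ ds ] (SizesBelow ∣ proj₂ c ∣ᶠ ds × (∀ {x} → x ∈ᶜ c → x ∈⋃ cs → x ∈⋃ ds))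
    shrink c []                 _   = [] , (λ ()) , λ { _ (_ , () , _) }
    shrink c@(r , I) (d@(s , J) ∷ cs) cs⊉
      with shrink c cs (cs⊉ ∘ there) | cs⊉ (here refl) | em 0ℓ {∃[ z ] (z ∈ᶜ c × z ∈ᶜ d)}
    ... | ds , below , covers | _ | no disjoint = ds , below , λ
      { x∈c (_ , here refl , x∈d) → contradiction (_ , x∈c , x∈d) disjoint
      ; x∈c (e , there e∈ , x∈e)  → covers x∈c (e , e∈ , x∈e)
      }
    ... | ds , below , covers | w , w∈c , w∉d | yes (z , z∈c , z∈d) = (z , I ∩ J) ∷ ds ,
      (λ { (here refl) → I∩J<I (⊆-or-⊈ I J) ; (there e∈) → below e∈ }) , λ
      { x∈c (_ , here refl , x∈d) → (z , I ∩ J) , here refl ,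
          ∈H-∩ I J (I ∩ J) (∈-∩⁺ I J) (~-trans I x∈c (~-sym I z∈c)) (~-trans J x∈d (~-sym J z∈d))
      ; x∈c (e , there e∈ , x∈e)  → let (e′ , e′∈ , x∈e′) = covers x∈c (e , e∈ , x∈e) in e′ , there e′∈ , x∈e′
      }
      where
      I∩J<I : I ⊆ J ⊎ I ⊈ J → ∣ I ∩ J ∣ᶠ < ∣ I ∣ᶠ
      I∩J<I (inj₁ I⊆J) = contradiction (~-trans J (~-⊆ I J I⊆J (~-trans I w∈c (~-sym I z∈c))) z∈d) w∉d
      I∩J<I (inj₂ I⊈J) = ∩-shrinks I J I⊈J

    -- The dichotomy is applied inside each coset. If `φ` is small in all of them, `shrink` lowers
    -- the size bound by one, which drives the induction on the rank.
    classify : ∀ φ n cs → SizesBelow (suc n) cs →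
               (∃[ ds ] (SizesBelow n ds × (∀ {x} → x ∈⋃ cs → Sat φ x → x ∈⋃ ds))) ⊎
               (∃[ j ] CosmallIn (_∈ᶜ List.lookup cs j) φ)
    classify φ n []       _     = inj₁ ([] , (λ ()) , λ { (_ , () , _) _ })
    classify φ n (c ∷ cs) below with small-or-cosmall (_∈ᶜ c) φ | classify φ n cs (below ∘ there)
    ... | inj₂ cosmall           | _                  = inj₂ (zero , cosmall)
    ... | inj₁ _                 | inj₂ (j , cosmall) = inj₂ (suc j , cosmall)
    ... | inj₁ (es , es⊉ , covers) | inj₁ (ds , ds-below , ds-covers)
      with es′ , es′-below , es′-covers ← shrink c es es⊉
      = inj₁ (es′ List.++ ds
             , [ (λ e∈ → ℕ.≤-trans (es′-below e∈) (ℕ.≤-pred (below (here refl)))) , ds-below ]′ ∘ List.∈-++⁻ es′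
             , λ { (_ , here refl , x∈c) p → ∈⋃-++⁺ˡ (es′-covers x∈c (covers x∈c p))
                 ; (d , there d∈ , x∈d)  p → ∈⋃-++⁺ʳ es′ (ds-covers (d , d∈ , x∈d) p) })

    coset-atom : ∀ {X : Set} x (env : X → Carrier) a I →
                 (x , env ⊩ₗ (ℤ.1ℤ , (ℤ.-1ℤ , a) ∷ [] , I)) ⇔ (x ~[ I ] env a)
    coset-atom x env a I = mk⇔ (∈H-resp I p) (∈H-resp I (sym p))
      where
      p : ℤ.1ℤ • x + (ℤ.-1ℤ • env a + 𝟘) ≈ x - env a
      p = +-cong (1•x≈x x) (trans (+-identityʳ _) (-‿cong (1•x≈x _)))

  module _ (M : Structure 𝓛) (𝓖≡M : 𝓖 ≡ₑ M) (N : Structure 𝓛) (𝓖≡N : 𝓖 ≡ₑ N) where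
    private
      module M = Dichotomy M 𝓖≡M
      module N = Dichotomy N 𝓖≡N

    -- Instead of expressing the inclusion by a formula, `forth` supplies a point of `M` that
    -- matches `y` on the atoms of `φ` and on the finitely many cosets.
    cover-extends : ∀ {f} → SameTheory M id N f → ∀ φ cs → (∀ {x} → M.Sat φ x → x M.∈⋃ cs) →
                    ∀ {y} → Holds N f φ (y ∷ []) → y N.∈⋃ List.map (map₁ f) cs
    cover-extends {f} same (m , ϕ , b) cs covers {y} p =
      pull (covers (preserved N 𝓖≡N M 𝓖≡M ϕ (y ∷ Vec.map f b) (x ∷ Vec.map id b) agree p))
      where
      view : Fin (suc m) → Maybe ∣ M ∣
      view i = Maybe.map (lookup b) (predFin i)
      cosetAtom : M.Coset → LinearAtom ∣ M ∣
      cosetAtom (r , J) = ℤ.1ℤ , (ℤ.-1ℤ , r) ∷ [] , J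
      formulaAtoms F : List (LinearAtom ∣ M ∣)
      formulaAtoms = List.map (linearise view) (atoms ϕ)
      F = formulaAtoms List.++ List.map cosetAtom cs
      found : ∃[ x ] (∀ {a} → a ∈ˡ F → (y N., f ⊩ₗ a) ⇔ (x M., id ⊩ₗ a))
      found = BackAndForth.forth N 𝓖≡N M 𝓖≡M F f id
        (λ a∈ → let e = sameTheory⇒agree M 𝓖≡M id N 𝓖≡N f same (eliminate F) a∈ in mk⇔ (from e) (to e)) y
      x : ∣ M ∣
      x = proj₁ found
      matches : ∀ {a} → a ∈ˡ F → (y N., f ⊩ₗ a) ⇔ (x M., id ⊩ₗ a)
      matches = proj₂ found
      lookup-view : ∀ {A : Set} (g : ∣ M ∣ → A) z i → lookup (z ∷ Vec.map g b) i ≡ maybe′ g z (view i)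
      lookup-view g z zero    = refl
      lookup-view g z (suc i) = Vec.lookup-map i g b
      agree : BackAndForth.Agree N 𝓖≡N M 𝓖≡M (atoms ϕ) (lookup (y ∷ Vec.map f b)) (lookup (x ∷ Vec.map id b))
      agree = BackAndForth.agree-linearise N 𝓖≡N M 𝓖≡M view (atoms ϕ) y x (lookup-view f y) (lookup-view id x)
        (matches ∘ List.∈-++⁺ˡ)
      pull : x M.∈⋃ cs → y N.∈⋃ List.map (map₁ f) cs
      pull ((r , J) , c∈ , x~r) = (f r , J) , List.∈-map⁺ (map₁ f) c∈ ,
        to (N.coset-atom y f r J) (from (matches (List.∈-++⁺ʳ formulaAtoms (List.∈-map⁺ cosetAtom c∈)))
          (from (M.coset-atom x id r J) x~r))

  -- In a rank n+1 formula covered by k cosets, each of the k+1 disjoint formulas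
  -- ψ i of rank n would be cosmall in one of the cosets, and cosmall sets meet.
  covered⇒¬MR≥ : ∀ n M (𝓖≡M : 𝓖 ≡ₑ M) φ cs → let open Dichotomy M 𝓖≡M in
                 SizesBelow n cs → (∀ {x} → Sat φ x → x ∈⋃ cs) → ¬ MR≥ (fin n) M φ
  covered⇒¬MR≥ zero M 𝓖≡M φ cs below covers (lift (x ∷ [] , p))
    with _ , c∈ , _ ← covers p with () ← below c∈
  covered⇒¬MR≥ (suc n) M 𝓖≡M φ cs below covers (N , (f , same) , ψ , ψ⊆φ , disjoint , ψ-rank) =
    clash (Fin.pigeonhole (ℕ.n<1+n (List.length ds)) (proj₁ ∘ generic ∘ Fin.toℕ))
    where
    𝓖≡N = sameTheory⇒≡ₑ {M = M} {a = id} {N = N} {c = f} 𝓖≡M same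
    module M = Dichotomy M 𝓖≡M
    module N = Dichotomy N 𝓖≡N
    ds : List N.Coset
    ds = List.map (map₁ f) cs
    ds-below : N.SizesBelow (suc n) ds
    ds-below d∈ with _ , c∈ , refl ← List.∈-map⁻ (map₁ f) d∈ = below c∈
    generic : ∀ i → ∃[ j ] N.CosmallIn (N._∈ᶜ List.lookup ds j) (ψ i)
    generic i with N.classify (ψ i) n ds ds-below
    ... | inj₂ cosmall = cosmall
    -- A cover by cosets of size below `n` contradicts the rank of `ψ i` by induction.
    ... | inj₁ (es , es-below , es-covers) = contradiction (ψ-rank i) (covered⇒¬MR≥ n N 𝓖≡N (ψ i) es es-below
      λ {x} p → es-covers (cover-extends M 𝓖≡M N 𝓖≡N same φ cs covers (ψ⊆φ i (x ∷ []) p)) p)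
    clash : ∃₂ (λ i j → i Fin.< j × proj₁ (generic (Fin.toℕ i)) ≡ proj₁ (generic (Fin.toℕ j))) → ⊥
    clash (i , j , i<j , same-coset) = disjoint (Fin.toℕ i) (Fin.toℕ j) (ℕ.<⇒≢ i<j) (proj₁ common ∷ []) (proj₂ common)
      where
      c : N.Coset
      c = List.lookup ds (proj₁ (generic (Fin.toℕ j)))
      common : ∃[ x ] (N.Sat (ψ (Fin.toℕ i)) x × N.Sat (ψ (Fin.toℕ j)) x)
      common = N.cosmall-meet (ψ (Fin.toℕ i)) (ψ (Fin.toℕ j)) (N.coset-affine c) (proj₁ c , N.≈⇒~ (proj₂ c) N.≈-refl)
        (≡.subst (λ k → N.CosmallIn (N._∈ᶜ List.lookup ds k) (ψ (Fin.toℕ i))) same-coset (proj₂ (generic (Fin.toℕ i))))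
        (proj₂ (generic (Fin.toℕ j)))

  -- Finitely many cosets have bounded sizes, so a formula they cover has finite rank. Formulas of
  -- rank at least ω are therefore cosmall in the whole model, and already two of them meet.
  ¬MR≥1+ω : ∀ M → 𝓖 ≡ₑ M → ∀ φ → ¬ MR≥ (suc ω) M φ
  ¬MR≥1+ω M 𝓖≡M φ (N , (f , same) , ψ , _ , disjoint , ψ-rank) =
    let x , p , q = N.cosmall-meet (ψ 0) (ψ 1) (λ _ _ _ → N.≈-refl) (N.𝟘 , N.≈-refl) (cosmall 0) (cosmall 1)
    in disjoint 0 1 (λ ()) (x ∷ []) (p , q)
    where
    𝓖≡N = sameTheory⇒≡ₑ {M = M} {a = id} {N = N} {c = f} 𝓖≡M same
    module N = Dichotomy N 𝓖≡N
    Whole : Pred ∣ N ∣ 0ℓ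
    Whole _ = N.𝟘 N.≈ N.𝟘
    cosmall : ∀ i → N.CosmallIn Whole (ψ i)
    cosmall i with N.small-or-cosmall Whole (ψ i)
    ... | inj₂ c = c
    ... | inj₁ (cs , _ , covers) with n , below ← N.sizesBelow cs
      = contradiction (ψ-rank i n) (covered⇒¬MR≥ n N 𝓖≡N (ψ i) cs below (covers N.≈-refl))

  ≼-refl : ∀ {M : Structure 𝓛} → M ≼ M
  ≼-refl = id , λ _ _ → mk⇔ id id

  -- Lower bounds for Morley rank and dp-rank

  without : ∀ {n} → Fin n → FinSubset
  without {n} α = filter (λ i → ¬? (i ℕ.≟ Fin.toℕ α)) (initial n)

  initial⊈without : ∀ {n} (α : Fin n) → initial n ⊈ without α
  initial⊈without {n} α = Fin.toℕ α , List.∈-upTo⁺ (Fin.toℕ<n α) ,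
    λ α∈ → proj₂ (List.∈-filter⁻ (λ i → ¬? (i ℕ.≟ Fin.toℕ α)) {xs = List.upTo n} α∈) refl

  initial⊆without-∪ : ∀ {n} {α β : Fin n} → α ≢ β → initial n ⊆ without α ∪ without β
  initial⊆without-∪ {n} {α} {β} α≢β {i} i∈ with i ℕ.≟ Fin.toℕ α
  ... | no i≢α   = ∈-∪⁺ (without α) (without β) (inj₁ (List.∈-filter⁺ (λ i → ¬? (i ℕ.≟ Fin.toℕ α)) i∈ i≢α))
  ... | yes refl = ∈-∪⁺ (without α) (without β)
    (inj₂ (List.∈-filter⁺ (λ i → ¬? (i ℕ.≟ Fin.toℕ β)) i∈ (α≢β ∘ Fin.toℕ-injective)))

  congruent : FinSubset → Fm 2
  congruent I = H′ I (var zero +′ -′ var (suc zero))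

  module LowerBounds (M : Structure 𝓛) (𝓖≡M : 𝓖 ≡ₑ M) where
    open Dichotomy M 𝓖≡M

    -- A line leaving H of `initial n` inside a coset of H of `initial (suc n)` has pairwise
    -- incongruent points; their cosets are the disjoint pieces, found in `M` itself.
    coset⊆⇒MR≥ : ∀ n φ r → (∀ {x} → x ∈ᶜ (r , initial n) → Sat φ x) → MR≥ (fin n) M φ
    coset⊆⇒MR≥ zero    φ r coset⊆ = lift (r ∷ [] , coset⊆ (≈⇒~ (initial 0) ≈-refl))
    coset⊆⇒MR≥ (suc n) φ r coset⊆ = M , ≼-refl , ψ ,
      (λ { i (x ∷ []) x∈ → coset⊆ (~-trans (initial (suc n))
             (~-⊆ (initial n) (initial (suc n)) (List.∈-upTo⁺ ∘ ℕ.m≤n⇒m≤1+n ∘ List.∈-upTo⁻) x∈)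
             (coset-affine (r , initial (suc n)) (≈⇒~ (initial (suc n)) ≈-refl) r′∈ i)) }) ,
      (λ { i j i≢j (x ∷ []) (p , q) →
             i≢j (line-injective (initial n) r′∉ i j (~-trans (initial n) (~-sym (initial n) p) q)) }) ,
      λ i → coset⊆⇒MR≥ n (ψ i) (line r r′ i) id
      where
      new : ∃[ w ] (w ∈ᶜ (r , initial (suc n)) × ¬ (w ∈ᶜ (r , initial n)))
      new = coset⊈coset r (initial (suc n)) r (initial n)
        (n , List.∈-upTo⁺ ℕ.≤-refl , ℕ.<-irrefl refl ∘ List.∈-upTo⁻)
      r′ = proj₁ new
      r′∈ = proj₁ (proj₂ new)
      r′∉ = proj₂ (proj₂ new)
      ψ : ℕ → PFormula 𝓛 Carrier 1
      ψ i = 1 , congruent (initial n) , line r r′ i ∷ []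

    MR≥ω : MR≥ ω M x≐x
    MR≥ω n = coset⊆⇒MR≥ n x≐x 𝟘 λ _ → ≈-refl

    -- Omitting two different indices leaves sets with union `I`, and all representatives lie in
    -- H_I, so every path is compatible. Depth `suc d` exceeds a supposed bound `d` and makes the
    -- list of constraints nonempty.
    inpPattern : ∀ d → InpPattern M (_≡ x≐x) (Fin (suc d))
    inpPattern d = record
      { arity = λ _ → 1
      ; φ = λ α → congruent (without α)
      ; k = λ _ → 2
      ; N = M
      ; M≼N = ≼-refl
      ; b = λ α i → b α i ∷ []
      ; row-inconsistent = rowInconsistent
      ; path-consistent = λ η → M , id , (λ _ _ → mk⇔ id id) , proj₁ (path η) ∷ [] , λ
          { _ (inj₁ (_ , refl , refl)) → ≈-refl
          ; _ (inj₂ (α , refl))        → proj₂ (path η) (List.∈-tabulate⁺ {f = constraint η} α)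
          }
      }
      where
      I = initial (suc d)
      new : ∀ α → ∃[ w ] (w ∈ᶜ (𝟘 , I) × ¬ (w ∈ᶜ (𝟘 , without α)))
      new α = coset⊈coset 𝟘 I 𝟘 (without α) (initial⊈without α)
      b : Fin (suc d) → ℕ → Carrier
      b α = line 𝟘 (proj₁ (new α))
      b∈ : ∀ α i → b α i ∈ᶜ (𝟘 , I)
      b∈ α = coset-affine (𝟘 , I) (≈⇒~ I ≈-refl) (proj₁ (proj₂ (new α)))

      constraint : (Fin (suc d) → ℕ) → Fin (suc d) → Coset
      constraint η α = b α (η α) , without α
      compatible : ∀ η → Compatible (List.tabulate (constraint η))
      compatible η p q with α , refl ← List.∈-tabulate⁻ {f = constraint η} p
                          | β , refl ← List.∈-tabulate⁻ {f = constraint η} q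
                       with α Fin.≟ β
      ... | yes refl = ≈⇒~ (without α ∪ without α) ≈-refl
      ... | no α≢β   = ~-⊆ I (without α ∪ without β) (initial⊆without-∪ α≢β)
                         (~-trans I (b∈ α (η α)) (~-sym I (b∈ β (η β))))
      path : ∀ η → ∃[ x ] (∀ {c} → c ∈ˡ List.tabulate (constraint η) → x ∈ᶜ c)
      path η = chineseRemainder (constraint η zero) (List.tabulate (constraint η ∘ suc)) (compatible η)

      rowInconsistent : ∀ α (i : Fin 2 → ℕ) → Injective _≡_ _≡_ i →
        ¬ Consistent M id (λ ψ → ∃[ j ] ψ ≡ (1 , congruent (without α) , b α (i j) ∷ []))
      rowInconsistent α i i-inj (N , c , same , x ∷ [] , row) = contradiction (i-inj i₀≡i₁) λ ()
        where
        module N = Model N (sameTheory⇒≡ₑ {M = M} {a = id} {N = N} {c = c} 𝓖≡M same)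
        J = without α
        b₀ = b α (i zero)
        b₁ = b α (i (suc zero))
        i₀≡i₁ : i zero ≡ i (suc zero)
        -- A common point in `N` makes the two parameters congruent there; this is a formula about
        -- parameters, so it already holds in `M`.
        i₀≡i₁ = line-injective J (proj₂ (proj₂ (new α))) (i zero) (i (suc zero))
          (from (same (congruent J) (b₀ ∷ b₁ ∷ []))
            (N.~-trans J (N.~-sym J (row _ (zero , refl))) (row _ (suc zero , refl))))

    ¬finiteDpRank : ¬ FiniteDpRank M
    ¬finiteDpRank (d , bounded) = ℕ.<-irrefl refl
      (Fin.injective⇒≤ (Injection.injective (bounded (Fin (suc d)) (inpPattern d))))


  -- ω-stability

  -- The number 2^m (2n + 1).
  pair : ℕ → ℕ → ℕ
  pair zero    n = suc (2 ℕ.* n)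
  pair (suc m) n = 2 ℕ.* pair m n

  pair-injective : ∀ m n m′ n′ → pair m n ≡ pair m′ n′ → m ≡ m′ × n ≡ n′
  pair-injective zero    n zero     n′ p = refl , ℕ.*-cancelˡ-≡ n n′ 2 (ℕ.suc-injective p)
  pair-injective zero    n (suc m′) n′ p = contradiction (≡.sym p) (ℕ.even≢odd (pair m′ n′) n)
  pair-injective (suc m) n zero     n′ p = contradiction p (ℕ.even≢odd (pair m n) n′)
  pair-injective (suc m) n (suc m′) n′ p =
    map₁ (≡.cong suc) (pair-injective m n m′ n′ (ℕ.*-cancelˡ-≡ (pair m n) (pair m′ n′) 2 p))

  infixr 4 _⊗_
  _⊗_ : ∀ {X Y : Set} → X ↣ ℕ → Y ↣ ℕ → (X × Y) ↣ ℕ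
  f ⊗ g = mk↣ {to = λ (x , y) → pair (Injection.to f x) (Injection.to g y)} λ {(x , y)} {(x′ , y′)} p →
    let p₁ , p₂ = pair-injective (Injection.to f x) (Injection.to g y) (Injection.to f x′) (Injection.to g y′) p
    in ≡.cong₂ _,_ (Injection.injective f p₁) (Injection.injective g p₂)

  maybe↣ℕ : ∀ {X : Set} → X ↣ ℕ → Maybe X ↣ ℕ
  maybe↣ℕ {X} f = mk↣ {to = encode} injective
    where
    encode : Maybe X → ℕ
    encode nothing  = 0
    encode (just x) = suc (Injection.to f x)
    injective : Injective _≡_ _≡_ encode
    injective {nothing} {nothing} p = refl
    injective {just x}  {just y}  p = ≡.cong just (Injection.injective f (ℕ.suc-injective p))

  list↣ℕ : ∀ {X : Set} → X ↣ ℕ → List X ↣ ℕ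
  list↣ℕ {X} f = mk↣ {to = encode} injective
    where
    encode : List X → ℕ
    encode []       = 0
    encode (x ∷ xs) = suc (pair (Injection.to f x) (encode xs))
    injective : Injective _≡_ _≡_ encode
    injective {[]}     {[]}     p = refl
    injective {x ∷ xs} {y ∷ ys} p =
      let p₁ , p₂ = pair-injective (Injection.to f x) (encode xs) (Injection.to f y) (encode ys) (ℕ.suc-injective p)
      in ≡.cong₂ _∷_ (Injection.injective f p₁) (injective p₂)

  vec↣ℕ : ∀ {X : Set} n → X ↣ ℕ → Vec X n ↣ ℕ
  vec↣ℕ n f = mk↣ {to = Injection.to (list↣ℕ f) ∘ Vec.toList}
    λ {v} {w} p → ≡.trans (≡.sym (Vec.cast-is-id refl v))
      (Vec.toList-injective refl v w (Injection.injective (list↣ℕ f) p))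

  ℕ↣ℕ : ℕ ↣ ℕ
  ℕ↣ℕ = mk↣ {to = id} id

  ℤ↣ℕ : ℤ ↣ ℕ
  ℤ↣ℕ = mk↣ {to = encode} injective
    where
    encode : ℤ → ℕ
    encode (ℤ.+ n)  = pair 0 n
    encode -[1+ n ] = pair 1 n
    injective : Injective _≡_ _≡_ encode
    injective {ℤ.+ m}     {ℤ.+ n}     p = ≡.cong ℤ.+_ (proj₂ (pair-injective 0 m 0 n p))
    injective {ℤ.+ m}     { -[1+ n ]} p = contradiction (proj₁ (pair-injective 0 m 1 n p)) λ ()
    injective { -[1+ m ]} {ℤ.+ n}     p = contradiction (proj₁ (pair-injective 1 m 0 n p)) λ ()
    injective { -[1+ m ]} { -[1+ n ]} p = ≡.cong -[1+_] (proj₂ (pair-injective 1 m 1 n p))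

  finSubset↣ℕ : FinSubset ↣ ℕ
  finSubset↣ℕ = mk↣ {to = Injection.to (list↣ℕ ℕ↣ℕ) ∘ proj₁} λ p → proj₁-injective (Injection.injective (list↣ℕ ℕ↣ℕ) p)
    where
    proj₁-injective : ∀ {I J : FinSubset} → proj₁ I ≡ proj₁ J → I ≡ J
    proj₁-injective {xs , l} {.xs , l′} refl = ≡.cong (xs ,_) (Linked.irrelevant ℕ.<-irrelevant l l′)

  least : ∀ {ℓ} {P : Pred ℕ ℓ} → ∃ P → ∃[ n ] (P n × (∀ {m} → P m → n ≤ m))
  least {ℓ} {P} (n , p) with search (suc n)
    where
    search : ∀ n → (∃[ m ] (P m × (∀ {m′} → P m′ → m ≤ m′))) ⊎ (∀ {m} → P m → n ≤ m)
    search zero    = inj₂ λ _ → ℕ.z≤n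
    search (suc n) with search n
    ... | inj₁ found = inj₁ found
    ... | inj₂ n≤ with em ℓ {P n}
    ...   | yes p = inj₁ (n , p , n≤)
    ...   | no ¬p = inj₂ λ q → ℕ.≤∧≢⇒< (n≤ q) λ { refl → ¬p q }
  ... | inj₁ found = found
  ... | inj₂ n<   = contradiction (n< p) (ℕ.<-irrefl refl)

  -- `Code` may depend on the representative, as it does for types coded through a chosen
  -- realisation. Closing it under the equality and taking the least code gives a map that respects
  -- the equality.
  countable : ∀ {c ℓ r} (S : Setoid c ℓ) (Code : Setoid.Carrier S → ℕ → Set r) →
              (∀ x → ∃ (Code x)) → (∀ {x y n} → Code x n → Code y n → Setoid._≈_ S x y) → Countable S
  countable {c} {ℓ} {r} S Code total unique = record
    { to        = λ x → proj₁ (code x)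
    ; cong      = λ {x} {y} x≈y → ℕ.≤-antisym
        (proj₂ (proj₂ (code x)) (resp (sym x≈y) (proj₁ (proj₂ (code y)))))
        (proj₂ (proj₂ (code y)) (resp x≈y (proj₁ (proj₂ (code x)))))
    ; injective = λ {x} {y} n≡m →
        let (x′ , x′≈x , p) = proj₁ (proj₂ (code x))
            (y′ , y′≈y , q) = proj₁ (proj₂ (code y))
        in trans (sym x′≈x) (trans (unique (≡.subst (Code x′) n≡m p) q) y′≈y)
    }
    where
    open Setoid S
    Code′ : Carrier → ℕ → Set _
    Code′ x n = ∃[ x′ ] (x′ ≈ x × Code x′ n)
    resp : ∀ {x y n} → x ≈ y → Code′ x n → Code′ y n
    resp x≈y (x′ , x′≈x , p) = x′ , trans x′≈x x≈y , p
    code : ∀ x → ∃[ n ] (Code′ x n × (∀ {m} → Code′ x m → n ≤ m))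
    code x = least (map₂ (λ p → x , Setoid.refl S , p) (total x))

  -- Finite descriptions of elements over parameters

  Datum : Set
  Datum = Maybe (LinearAtom ℕ)

  Data : Set
  Data = Datum × List Datum

  data↣ℕ : Data ↣ ℕ
  data↣ℕ = datum↣ℕ ⊗ list↣ℕ datum↣ℕ
    where
    datum↣ℕ : Datum ↣ ℕ
    datum↣ℕ = maybe↣ℕ (ℤ↣ℕ ⊗ list↣ℕ (ℤ↣ℕ ⊗ ℕ↣ℕ) ⊗ finSubset↣ℕ)

  indices : Datum → List ℕ
  indices nothing            = []
  indices (just (_ , _ , I)) = proj₁ I

  infixr 5 _◂_ _◂⁺_
  _◂_ : ∀ {C : Set} → C → (ℕ → C) → ℕ → C
  (x ◂ env) zero    = x
  (x ◂ env) (suc e) = env e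

  _◂⁺_ : ∀ {C : Set} {n} → Vec C n → (ℕ → C) → ℕ → C
  []       ◂⁺ env = env
  (x ∷ xs) ◂⁺ env = x ◂ (xs ◂⁺ env)

  predℕ : ℕ → Maybe ℕ
  predℕ zero    = nothing
  predℕ (suc e) = just e

  ◂-predℕ : ∀ {C : Set} (x : C) env e → (x ◂ env) e ≡ maybe′ env x (predℕ e)
  ◂-predℕ x env zero    = refl
  ◂-predℕ x env (suc e) = refl

  module Describe (N : Structure 𝓛) (𝓖≡N : 𝓖 ≡ₑ N) where
    open Evaluation N 𝓖≡N public

    Witness : Carrier → (ℕ → Carrier) → Pred FinSubset 0ℓ → LinearAtom ℕ → Set
    Witness x env U a@(q , s , I) = q ≢ ℤ.0ℤ × U I × (x , env ⊩ₗ a)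

    DescribedBy : Carrier → (ℕ → Carrier) → Pred FinSubset 0ℓ → Datum → Set
    DescribedBy x env U nothing  = ∀ a → ¬ Witness x env U a
    DescribedBy x env U (just a) = Witness x env U a

    -- A linear atom a₀ that x satisfies with a nonzero coefficient, and for each i in
    -- its index set I₀ one whose index set omits i; `nothing' if there is none.  As
    -- H_K is the intersection of H_(K ∪ I₀) and of one H_(K ∪ L) with i ∉ L for each
    -- i ∈ I₀ outside K, these decide membership of x in every coset of H_K.
    Describes : Carrier → (ℕ → Carrier) → Data → Set
    Describes x env (d , ds) =
      DescribedBy x env (λ _ → ⊤) d × Pointwiseˡ.Pointwise (λ i → DescribedBy x env (λ I → ¬ (i ∈ I))) (indices d) ds

    -- Each entry is described over the later entries and the parameters, so numbers name first the
    -- rest of the tuple and then the values of `env`.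
    Describes⁺ : ∀ {n} → Vec Carrier n → (ℕ → Carrier) → Vec Data n → Set
    Describes⁺ []       env []       = ⊤
    Describes⁺ (x ∷ xs) env (D ∷ Ds) = Describes x (xs ◂⁺ env) D × Describes⁺ xs env Ds

    datum : ∀ x env U → ∃ (DescribedBy x env U)
    datum x env U with em 0ℓ {∃ (Witness x env U)}
    ... | yes (a , w) = just a , w
    ... | no none     = nothing , λ a w → none (a , w)

    description : ∀ x env → ∃ (Describes x env)
    description x env = let (d , p) = datum x env (λ _ → ⊤) ; (ds , ps) = data-for (indices d) in (d , ds) , p , ps
      where
      data-for : ∀ is → ∃ (Pointwiseˡ.Pointwise (λ i → DescribedBy x env (λ I → ¬ (i ∈ I))) is)
      data-for []       = [] , []
      data-for (i ∷ is) = let (d , p) = datum x env (λ I → ¬ (i ∈ I)) ; (ds , ps) = data-for is in d ∷ ds , p ∷ ps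

    description⁺ : ∀ {n} (xs : Vec Carrier n) env → ∃ (Describes⁺ xs env)
    description⁺ []       env = [] , tt
    description⁺ (x ∷ xs) env =
      let (D , p) = description x (xs ◂⁺ env) ; (Ds , ps) = description⁺ xs env in D ∷ Ds , p , ps

    narrow : ∀ K is S {x} → x ∈H S → (∀ {i} → i ∈ˡ is → ∃[ L ] (x ∈H L × (i ∈ L → i ∈ K))) →
             ∃[ T ] (x ∈H T × T ⊆ S × (∀ {i} → i ∈ˡ is → i ∈ T → i ∈ K))
    narrow K []       S x∈S _  = S , x∈S , id , λ ()
    narrow K (i ∷ is) S x∈S Ls with narrow K is S x∈S (Ls ∘ there) | Ls (here refl)
    ... | T , x∈T , T⊆S , T∩is⊆K | L , x∈L , i∈L⇒i∈K = T ∩ L , ∈H-∩ T L (T ∩ L) (∈-∩⁺ T L) x∈T x∈L ,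
      T⊆S ∘ proj₁ ∘ ∈-∩⁻ T L , λ
        { (here refl) i∈ → i∈L⇒i∈K (proj₂ (∈-∩⁻ T L i∈))
        ; (there j∈)  j∈T∩L → T∩is⊆K j∈ (proj₁ (∈-∩⁻ T L j∈T∩L))
        }

    ∈H-remove : ∀ K I {x} → x ∈H K ∪ I →
                (∀ {i} → i ∈ I → ¬ (i ∈ K) → ∃[ L ] (¬ (i ∈ L) × x ∈H K ∪ L)) → x ∈H K
    ∈H-remove K I {x} x∈ Ls =
      let (T , x∈T , T⊆K∪I , T∩I⊆K) = narrow K (proj₁ I) (K ∪ I) x∈ Ls′
      in ∈H-⊆ T K (λ i∈T → [ id , (λ i∈I → T∩I⊆K i∈I i∈T) ]′ (∈-∪⁻ K I (T⊆K∪I i∈T))) x∈T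
      where
      Ls′ : ∀ {i} → i ∈ˡ proj₁ I → ∃[ L ] (x ∈H L × (i ∈ L → i ∈ K))
      Ls′ {i} i∈I with i ∈? K
      ... | yes i∈K = K ∪ I , x∈ , λ _ → i∈K
      ... | no i∉K with L , i∉L , x∈′ ← Ls i∈I i∉K = K ∪ L , x∈′ , λ i∈ → [ id , ⊥-elim ∘ i∉L ]′ (∈-∪⁻ K L i∈)

  pointwise-common : ∀ {X Y : Set} {R S : X → Y → Set} {xs ys x} →
                     Pointwiseˡ.Pointwise R xs ys → Pointwiseˡ.Pointwise S xs ys →
                     x ∈ˡ xs → ∃[ y ] (R x y × S x y)
  pointwise-common (r ∷ _)  (s ∷ _)  (here refl) = _ , r , s
  pointwise-common (_ ∷ rs) (_ ∷ ss) (there x∈)  = pointwise-common rs ss x∈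

  AgreeAll : ∀ {X : Set} N 𝓖≡N N′ 𝓖≡N′ (env : X → ∣ N ∣) (env′ : X → ∣ N′ ∣) → Set
  AgreeAll N 𝓖≡N N′ 𝓖≡N′ env env′ = ∀ F → BackAndForth.Agree N 𝓖≡N N′ 𝓖≡N′ F env env′

  -- An atom `b` of the common description ties `x` and `x′` to its roots. The congruence between
  -- the roots of `a` and `b` is an eliminant over the environments, so it passes to `N′`, and
  -- `∈H-remove` combines the resulting congruences of `x′`.
  describes-transfer : ∀ N 𝓖≡N N′ 𝓖≡N′ {env : ℕ → ∣ N ∣} {env′ : ℕ → ∣ N′ ∣} → AgreeAll N 𝓖≡N N′ 𝓖≡N′ env env′ →
    ∀ {x x′} D → Describe.Describes N 𝓖≡N x env D → Describe.Describes N′ 𝓖≡N′ x′ env′ D →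
    ∀ a → Evaluation._,_⊩ₗ_ N 𝓖≡N x env a → Evaluation._,_⊩ₗ_ N′ 𝓖≡N′ x′ env′ a
  describes-transfer N 𝓖≡N N′ 𝓖≡N′ {env} {env′} agree {x} {x′} (d , ds) (p , ps) (p′ , ps′) a@(q , s , K) x⊩a
    with q ℤ.≟ ℤ.0ℤ
  ... | yes refl = from (N′.⊩ₗ-0 s K x′ env′) (to (agree ((s , K) ∷ []) (here refl)) (to (N.⊩ₗ-0 s K x env) x⊩a))
    where
    module N = Describe N 𝓖≡N
    module N′ = Describe N′ 𝓖≡N′
  ... | no q≢0 = from (N′.⊩ₗ⇔∈coset x′ env′ a q≢0) (conclude d p p′ ps ps′)
    where
    module N = Describe N 𝓖≡N
    module N′ = Describe N′ 𝓖≡N′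
    r′ = N′.root env′ a
    congruent-to : ∀ U b → N.Witness x env U b → N′.Witness x′ env′ U b →
                   x′ N′.~[ K ∪ proj₂ (proj₂ b) ] r′
    congruent-to U b@(_ , _ , L) (b≢0 , _ , x⊩b) (_ , _ , x′⊩b) =
      N′.~-trans (K ∪ L) (N′.~-∪ʳ K L (to (N′.⊩ₗ⇔∈coset x′ env′ b b≢0) x′⊩b)) (N′.~-sym (K ∪ L) r′~)
      where
      r~ : N.root env a N.~[ K ∪ L ] N.root env b
      r~ = N.~-trans (K ∪ L) (N.~-sym (K ∪ L) (N.~-∪ˡ K L (to (N.⊩ₗ⇔∈coset x env a q≢0) x⊩a)))
             (N.~-∪ʳ K L (to (N.⊩ₗ⇔∈coset x env b b≢0) x⊩b))
      r′~ : r′ N′.~[ K ∪ L ] N′.root env′ b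
      r′~ = to (N′.⊩eliminant⇔~ env′ a b q≢0 b≢0)
        (to (agree (eliminant a b ∷ []) (here refl)) (from (N.⊩eliminant⇔~ env a b q≢0 b≢0) r~))

    conclude : ∀ d → N.DescribedBy x env (λ _ → ⊤) d → N′.DescribedBy x′ env′ (λ _ → ⊤) d →
      Pointwiseˡ.Pointwise (λ i → N.DescribedBy x env (λ I → ¬ (i ∈ I))) (indices d) ds →
      Pointwiseˡ.Pointwise (λ i → N′.DescribedBy x′ env′ (λ I → ¬ (i ∈ I))) (indices d) ds →
      x′ N′.~[ K ] r′
    conclude nothing  none _  _  _   = contradiction (q≢0 , tt , x⊩a) (none a)
    conclude (just b@(_ , _ , I)) w w′ ps ps′ = N′.∈H-remove K I (congruent-to (λ _ → ⊤) b w w′) omit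
      where
      omit : ∀ {i} → i ∈ I → ¬ (i ∈ K) → ∃[ L ] (¬ (i ∈ L) × x′ N′.~[ K ∪ L ] r′)
      omit {i} i∈I i∉K with pointwise-common ps ps′ i∈I
      -- `a` itself is an atom whose index set omits `i`, so the entry cannot be `nothing`.
      ... | nothing , none , _  = contradiction (q≢0 , i∉K , x⊩a) (none a)
      ... | just c@(_ , _ , L) , u@(_ , i∉L , _) , u′ = L , i∉L , congruent-to (λ I → ¬ (i ∈ I)) c u u′

  describes-agree : ∀ N 𝓖≡N N′ 𝓖≡N′ {env : ℕ → ∣ N ∣} {env′ : ℕ → ∣ N′ ∣} → AgreeAll N 𝓖≡N N′ 𝓖≡N′ env env′ →
    ∀ {n} (xs : Vec ∣ N ∣ n) (xs′ : Vec ∣ N′ ∣ n) Ds →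
    Describe.Describes⁺ N 𝓖≡N xs env Ds → Describe.Describes⁺ N′ 𝓖≡N′ xs′ env′ Ds →
    AgreeAll N 𝓖≡N N′ 𝓖≡N′ (xs ◂⁺ env) (xs′ ◂⁺ env′)
  describes-agree N 𝓖≡N N′ 𝓖≡N′ agree []       []         []       _        _          = agree
  describes-agree N 𝓖≡N N′ 𝓖≡N′ {env} {env′} agree (x ∷ xs) (x′ ∷ xs′) (D ∷ Ds) (p , ps) (p′ , ps′) F =
    BackAndForth.agree-linearise N 𝓖≡N N′ 𝓖≡N′ predℕ F x x′ (◂-predℕ x (xs ◂⁺ env)) (◂-predℕ x′ (xs′ ◂⁺ env′))
      λ {a} _ → mk⇔ (describes-transfer N 𝓖≡N N′ 𝓖≡N′ ih D p p′ a)
                    (describes-transfer N′ 𝓖≡N′ N 𝓖≡N (λ F a∈ → mk⇔ (from (ih F a∈)) (to (ih F a∈))) D p′ p a)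
    where
    ih : AgreeAll N 𝓖≡N N′ 𝓖≡N′ (xs ◂⁺ env) (xs′ ◂⁺ env′)
    ih = describes-agree N 𝓖≡N N′ 𝓖≡N′ agree xs xs′ Ds ps ps′

  -- Counting types over a countable set

  module Stability (M : Structure 𝓛) (𝓖≡M : 𝓖 ≡ₑ M) (A : Pred ∣ M ∣ 0ℓ) (count : Countable (SubsetSetoid M A)) where
    index : ∃ A → ℕ
    index = Injection.to count

    element : ℕ → Maybe (∃ A)
    element e with em 0ℓ {∃[ a ] index a ≡ e}
    ... | yes (a , _) = just a
    ... | no _        = nothing

    -- Numbers that are no index of an element of `A` are interpreted by 𝟘 in `env`; dropping their
    -- monomials leaves a form over `A`, to which `SameTheory` applies.
    prune : Form ℕ → Form (∃ A)
    prune []            = []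
    prune ((k , e) ∷ f) with element e
    ... | nothing = prune f
    ... | just a  = (k , a) ∷ prune f

    idx : ∀ n {m} → Vec (∃ A) m → Fin (n ℕ.+ m) → ℕ
    idx zero    b i       = index (lookup b i)
    idx (suc n) b zero    = 0
    idx (suc n) b (suc i) = suc (idx n b i)

    module Extension (N : Structure 𝓛) (c : ∃ A → ∣ N ∣) (same : SameTheory M proj₁ N c) where
      𝓖≡N : 𝓖 ≡ₑ N
      𝓖≡N = sameTheory⇒≡ₑ {M = M} {a = proj₁ {B = A}} {N = N} {c = c} 𝓖≡M same

      open Describe N 𝓖≡N public

      env : ℕ → Carrier
      env e = maybe′ c 𝟘 (element e)

      lin-prune : ∀ f → lin f env ≈ lin (prune f) c
      lin-prune []            = ≈-refl
      lin-prune ((k , e) ∷ f) with element e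
      ... | nothing = trans (+-congʳ (•-𝟘 k)) (trans (+-identityˡ _) (lin-prune f))
      ... | just a  = +-congˡ (lin-prune f)

      ⊩-prune : ∀ f I → (env ⊩ (f , I)) ⇔ (c ⊩ (prune f , I))
      ⊩-prune f I = mk⇔ (∈H-resp I (lin-prune f)) (∈H-resp I (sym (lin-prune f)))

      env-index : ∀ a → env (index a) ≈ c a
      env-index a with em 0ℓ {∃[ a′ ] index a′ ≡ index a}
      -- The element recovered from the index is only equal to `a` in the sense of `M`; the formula
      -- `x = y` carries this to `N`.
      ... | yes (a′ , p) = to (same (var zero ≐ var (suc zero)) (a′ ∷ a ∷ [])) (Injection.injective count p)
      ... | no none      = contradiction (a , refl) none

      lookup-idx : ∀ {n m} (xs : Vec Carrier n) (b : Vec (∃ A) m) i →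
                   (xs ◂⁺ env) (idx n b i) ≈ lookup (xs ++ Vec.map c b) i
      lookup-idx []       b i       = trans (env-index (lookup b i)) (reflexive (≡.sym (Vec.lookup-map i c b)))
      lookup-idx (x ∷ xs) b zero    = ≈-refl
      lookup-idx (x ∷ xs) b (suc i) = lookup-idx xs b i

      ⊩-idx : ∀ {n m} (xs : Vec Carrier n) (b : Vec (∃ A) m) f I →
              ((xs ◂⁺ env) ⊩ (List.map (map₂ (idx n b)) f , I)) ⇔ (lookup (xs ++ Vec.map c b) ⊩ (f , I))
      ⊩-idx {n} xs b f I = mk⇔ (∈H-resp I p) (∈H-resp I (sym p))
        where
        p : lin (List.map (map₂ (idx n b)) f) (xs ◂⁺ env) ≈ lin f (lookup (xs ++ Vec.map c b))
        p = trans (reflexive (lin-rename (idx n b) f (xs ◂⁺ env))) (lin-cong f (lookup-idx xs b))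

    module _ {n : ℕ} where
      open CompleteType

      module Realised (p : CompleteType M A n) where
        private
          real = consistent p
          N = proj₁ real
          c = proj₁ (proj₂ real)
          same = proj₁ (proj₂ (proj₂ real))
        open Extension N c same public
        xs : Vec ∣ N ∣ n
        xs = proj₁ (proj₂ (proj₂ (proj₂ real)))

        model = N
        names = c
        names-same = same

        holds : ∀ φ → mem p φ → Holds N c φ xs
        holds = proj₂ (proj₂ (proj₂ (proj₂ real)))

        holds⁻ : ∀ φ → Holds N c φ xs → mem p φ
        holds⁻ φ h with complete p φ
        ... | inj₁ p  = p
        ... | inj₂ ¬p = contradiction h (holds (¬ₚ φ) ¬p)

      env-agree : ∀ p q → AgreeAll (Realised.model p) (Realised.𝓖≡N p) (Realised.model q) (Realised.𝓖≡N q)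
                                   (Realised.env p) (Realised.env q)
      env-agree p q F {f , I} _ = mk⇔
        (from (q.⊩-prune f I) ∘ to (same-f q) ∘ from (same-f p) ∘ to (p.⊩-prune f I))
        (from (p.⊩-prune f I) ∘ to (same-f p) ∘ from (same-f q) ∘ to (q.⊩-prune f I))
        where
        module p = Realised p
        module q = Realised q
        same-f : ∀ r → _ ⇔ _
        same-f r = sameTheory⇒agree M 𝓖≡M proj₁
          (Realised.model r) (Realised.𝓖≡N r) (Realised.names r) (Realised.names-same r)
          ((prune f , I) ∷ []) (here refl)

      Code : CompleteType M A n → ℕ → Set
      Code p k = ∃[ Ds ] (Injection.to (vec↣ℕ n data↣ℕ) Ds ≡ k × Realised.Describes⁺ p (Realised.xs p) (Realised.env p) Ds)

      code-total : ∀ p → ∃ (Code p)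
      code-total p = let (Ds , d) = Realised.description⁺ p (Realised.xs p) (Realised.env p) in _ , Ds , refl , d

      -- Equal codes give realisations, possibly in different models, with one description; they
      -- agree on all atoms over `A`, and completeness of `q` turns truth back into membership.
      same-code : ∀ {p q k} → Code p k → Code q k → ∀ φ → mem p φ → mem q φ
      same-code {p} {q} (Ds , refl , d) (Ds′ , eq , d′) (m , ϕ , b) φ∈p
        with refl ← Injection.injective (vec↣ℕ n data↣ℕ) {Ds′} {Ds} eq
        = q.holds⁻ (m , ϕ , b) (preserved p.model p.𝓖≡N q.model q.𝓖≡N ϕ
            (p.xs ++ Vec.map p.names b) (q.xs ++ Vec.map q.names b) agree (p.holds (m , ϕ , b) φ∈p))
        where
        module p = Realised p
        module q = Realised q
        agree : BackAndForth.Agree p.model p.𝓖≡N q.model q.𝓖≡N (atoms ϕ)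
                  (lookup (p.xs ++ Vec.map p.names b)) (lookup (q.xs ++ Vec.map q.names b))
        agree {f , I} _ = mk⇔
          (to (q.⊩-idx q.xs b f I) ∘ to e ∘ from (p.⊩-idx p.xs b f I))
          (to (p.⊩-idx p.xs b f I) ∘ from e ∘ from (q.⊩-idx q.xs b f I))
          where
          e = describes-agree p.model p.𝓖≡N q.model q.𝓖≡N (env-agree p q) p.xs q.xs Ds d d′
                ((List.map (map₂ (idx n b)) f , I) ∷ []) (here refl)

      countableTypes : Countable (TypeSpace M A n)
      countableTypes = countable (TypeSpace M A n) Code code-total
        λ {p} {q} cp cq φ → mk⇔ (same-code {p} {q} cp cq φ) (same-code {q} {p} cq cp φ)

proposition7p1 : (∀ ℓ → ExcludedMiddle ℓ) → ωStable 𝓖 × HasMorleyRank 𝓖 ω × (¬ FiniteDpRank 𝓖)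
proposition7p1 em =
  (λ M 𝓖≡M A count n → Stability.countableTypes M 𝓖≡M A count) ,
  (LowerBounds.MR≥ω 𝓖 𝓖≡𝓖 , ¬MR≥1+ω 𝓖 𝓖≡𝓖 x≐x) ,
  LowerBounds.¬finiteDpRank 𝓖 𝓖≡𝓖
  where
  open Classical em
  𝓖≡𝓖 : 𝓖 ≡ₑ 𝓖
  𝓖≡𝓖 _ = mk⇔ id id
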